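{- For every positive integer $n$, \[\alpha(n)=\begin{cases}2n-1,& n\in\{1,2\},\\ 2n-2,& n\in\{3,4\},\\ 2n-3,& n>4.\end{cases}\]
   Context: A family $e_1,\dots,e_k$ of complex $n\times n$ matrices is called anticommuting if $e_ie_j=-e_je_i$ for all distinct $i,j\in\{1,\dots,k\}$. For a positive integer $n$, $\alpha(n)$ denotes the largest $k$ such that there exists an anticommuting family $e_1,\dots,e_k\in\mathbb{C}^{n\times n}$ with $e_1^2,\dots,e_k^2\neq 0$. -}

module Defs where

open import Algebra.Bundles using (CommutativeMonoid)
open import Algebra.Bundles.Raw using (RawRing)
import Algebra.Definitions.RawMonoid as RawMonoidDefs
import Algebra.Properties.CommutativeSemigroup as CommutativeSemigroupProperties
open import Data.Fin.Base using (Fin)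
open import Data.Nat.Base as ℕ using (ℕ)
import Data.Nat.Properties as ℕP
open import Data.Product.Base using (∃-syntax; _×_; _,_)
open import Data.Rational.Base
  using (ℚ; 0ℚ; 1ℚ; ½; _+_; _*_; _-_; -_; _<_; _≤_; ∣_∣; 1/_; Positive; positive; NonZero)
open import Data.Rational.Properties
open import Relation.Binary.PropositionalEquality
  using (_≡_; _≢_; sym; trans; cong; cong₂; subst; module ≡-Reasoning)
open import Relation.Nullary.Negation.Core using (¬_)

-- The real numbers are the setoid of Cauchy sequences of rationals, two
-- sequences being equal when their difference tends to 0.

IsCauchy : (ℕ → ℚ) → Set
IsCauchy x =
  ∀ ε → 0ℚ < ε → ∃[ N ] (∀ m n → N ℕ.≤ m → N ℕ.≤ n → ∣ x m - x n ∣ < ε)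

record ℝ : Set where
  constructor mkℝ
  field
    seq    : ℕ → ℚ
    cauchy : IsCauchy seq
open ℝ public

infix 4 _≈ℝ_
_≈ℝ_ : ℝ → ℝ → Set
x ≈ℝ y = ∀ ε → 0ℚ < ε → ∃[ N ] (∀ n → N ℕ.≤ n → ∣ seq x n - seq y n ∣ < ε)

private
  open CommutativeSemigroupProperties
    (CommutativeMonoid.commutativeSemigroup +-0-commutativeMonoid) using (interchange)

  half : ℚ → ℚ
  half ε = ½ * ε

  half-pos : ∀ {ε} → 0ℚ < ε → 0ℚ < half ε
  half-pos {ε} 0<ε = positive⁻¹ (half ε) {{pos*pos⇒pos ½ ε {{positive 0<ε}}}}

  half+half : ∀ ε → half ε + half ε ≡ ε
  half+half ε = trans (sym (*-distribʳ-+ ε ½ ½)) (*-identityˡ ε)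

  +-difference : ∀ a b c d → (a + b) - (c + d) ≡ (a - c) + (b - d)
  +-difference a b c d = trans (cong ((a + b) +_) (neg-distrib-+ c d))
    (interchange a b (- c) (- d))

  difference-+ : ∀ a b → (a - b) + b ≡ a
  difference-+ a b =
    trans (+-assoc a (- b) b) (trans (cong (a +_) (+-inverseˡ b)) (+-identityʳ a))

  *-difference : ∀ a b c d → a * b - c * d ≡ a * (b - d) + d * (a - c)
  *-difference a b c d = sym (begin
    a * (b - d) + d * (a - c)
      ≡⟨ cong₂ _+_ (expand a b d) (expand d a c) ⟩
    (a * b - a * d) + (d * a - d * c)
      ≡⟨ cong₂ (λ p q → (a * b - a * d) + (p - q)) (*-comm d a) (*-comm d c) ⟩
    (a * b - a * d) + (a * d - c * d)
      ≡⟨ sym (+-assoc (a * b - a * d) (a * d) (- (c * d))) ⟩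
    ((a * b - a * d) + a * d) - c * d
      ≡⟨ cong (_- c * d) (difference-+ (a * b) (a * d)) ⟩
    a * b - c * d ∎)
    where
    open ≡-Reasoning
    expand : ∀ p q r → p * (q - r) ≡ p * q - p * r
    expand p q r = trans (*-distribˡ-+ p q (- r))
      (cong (p * q +_) (sym (neg-distribʳ-* p r)))

const-cauchy : ∀ q → IsCauchy (λ _ → q)
const-cauchy q ε 0<ε =
  0 , λ _ _ _ _ → subst (λ d → ∣ d ∣ < ε) (sym (+-inverseʳ q)) 0<ε

+-cauchy : ∀ x y → IsCauchy x → IsCauchy y → IsCauchy (λ n → x n + y n)
+-cauchy x y cx cy ε 0<ε
  with cx (half ε) (half-pos 0<ε) | cy (half ε) (half-pos 0<ε)
... | M , hx | N , hy = M ℕ.⊔ N , λ m n p q → begin-strict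
  ∣ (x m + y m) - (x n + y n) ∣
    ≡⟨ cong ∣_∣ (+-difference (x m) (y m) (x n) (y n)) ⟩
  ∣ (x m - x n) + (y m - y n) ∣
    ≤⟨ ∣p+q∣≤∣p∣+∣q∣ (x m - x n) (y m - y n) ⟩
  ∣ x m - x n ∣ + ∣ y m - y n ∣
    <⟨ +-mono-< (hx m n (ℕP.m⊔n≤o⇒m≤o M N p) (ℕP.m⊔n≤o⇒m≤o M N q))
                (hy m n (ℕP.m⊔n≤o⇒n≤o M N p) (ℕP.m⊔n≤o⇒n≤o M N q)) ⟩
  half ε + half ε
    ≡⟨ half+half ε ⟩
  ε ∎
  where open ≤-Reasoning

neg-cauchy : ∀ x → IsCauchy x → IsCauchy (λ n → - x n)
neg-cauchy x cx ε 0<ε with cx ε 0<ε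
... | N , h = N , λ m n p q → subst (_< ε) (sym (lemma (x m) (x n))) (h m n p q)
  where
  lemma : ∀ a b → ∣ (- a) - (- b) ∣ ≡ ∣ a - b ∣
  lemma a b = trans
    (cong ∣_∣ (sym (neg-distrib-+ a (- b))))
    (∣-p∣≡∣p∣ (a - b))

private
  eventually-bounded : ∀ z → IsCauchy z →
    ∃[ N ] ∃[ B ] (0ℚ < B × (∀ m → N ℕ.≤ m → ∣ z m ∣ ≤ B))
  eventually-bounded z cz with cz 1ℚ (positive⁻¹ 1ℚ)
  ... | N , h = N , 1ℚ + ∣ z N ∣ , +-mono-<-≤ (positive⁻¹ 1ℚ) (0≤∣p∣ (z N)) , bound
    where
    open ≤-Reasoning
    bound : ∀ m → N ℕ.≤ m → ∣ z m ∣ ≤ 1ℚ + ∣ z N ∣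
    bound m N≤m = begin
      ∣ z m ∣
        ≡⟨ cong ∣_∣ (sym (difference-+ (z m) (z N))) ⟩
      ∣ (z m - z N) + z N ∣
        ≤⟨ ∣p+q∣≤∣p∣+∣q∣ (z m - z N) (z N) ⟩
      ∣ z m - z N ∣ + ∣ z N ∣
        ≤⟨ +-monoˡ-≤ ∣ z N ∣ (<⇒≤ (h m N N≤m ℕP.≤-refl)) ⟩
      1ℚ + ∣ z N ∣ ∎

  divide : ∀ {B ε} → 0ℚ < B → 0ℚ < ε → ∃[ δ ] (0ℚ < δ × B * δ ≡ ε)
  divide {B} {ε} 0<B 0<ε =
    1/ B * ε
    , positive⁻¹ (1/ B * ε) {{pos*pos⇒pos (1/ B) {{1/pos⇒pos B}} ε {{positive 0<ε}}}}
    , trans (sym (*-assoc B (1/ B) ε)) (trans (cong (_* ε) (*-inverseʳ B)) (*-identityˡ ε))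
    where
    instance
      B-pos : Positive B
      B-pos = positive 0<B
      B-nonZero : NonZero B
      B-nonZero = pos⇒nonZero B

  *-bound : ∀ p q {B δ} → 0ℚ < B → ∣ p ∣ ≤ B → ∣ q ∣ < δ → ∣ p * q ∣ < B * δ
  *-bound p q {B} {δ} 0<B p≤B q<δ = begin-strict
    ∣ p * q ∣      ≡⟨ ∣p*q∣≡∣p∣*∣q∣ p q ⟩
    ∣ p ∣ * ∣ q ∣  ≤⟨ *-monoʳ-≤-nonNeg ∣ q ∣ {{∣-∣-nonNeg q}} p≤B ⟩
    B * ∣ q ∣      <⟨ *-monoʳ-<-pos B {{positive 0<B}} q<δ ⟩
    B * δ          ∎
    where open ≤-Reasoning

*-cauchy : ∀ x y → IsCauchy x → IsCauchy y → IsCauchy (λ n → x n * y n)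
*-cauchy x y cx cy ε 0<ε
  with eventually-bounded x cx | eventually-bounded y cy
... | M₁ , B , 0<B , x≤B | N₁ , C , 0<C , y≤C
  with divide 0<B (half-pos 0<ε) | divide 0<C (half-pos 0<ε)
... | δ , 0<δ , Bδ≡ | η , 0<η , Cη≡
  with cy δ 0<δ | cx η 0<η
... | N₂ , hy | M₂ , hx = (M₁ ℕ.⊔ N₁) ℕ.⊔ (M₂ ℕ.⊔ N₂) , close
  where
  open ≤-Reasoning

  K : ℕ
  K = (M₁ ℕ.⊔ N₁) ℕ.⊔ (M₂ ℕ.⊔ N₂)

  fst : ∀ {m} → K ℕ.≤ m → M₁ ℕ.⊔ N₁ ℕ.≤ m
  fst = ℕP.m⊔n≤o⇒m≤o (M₁ ℕ.⊔ N₁) (M₂ ℕ.⊔ N₂)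

  snd : ∀ {m} → K ℕ.≤ m → M₂ ℕ.⊔ N₂ ℕ.≤ m
  snd = ℕP.m⊔n≤o⇒n≤o (M₁ ℕ.⊔ N₁) (M₂ ℕ.⊔ N₂)

  close : ∀ m n → K ℕ.≤ m → K ℕ.≤ n → ∣ x m * y m - x n * y n ∣ < ε
  close m n p q = begin-strict
    ∣ x m * y m - x n * y n ∣
      ≡⟨ cong ∣_∣ (*-difference (x m) (y m) (x n) (y n)) ⟩
    ∣ x m * (y m - y n) + y n * (x m - x n) ∣
      ≤⟨ ∣p+q∣≤∣p∣+∣q∣ (x m * (y m - y n)) (y n * (x m - x n)) ⟩
    ∣ x m * (y m - y n) ∣ + ∣ y n * (x m - x n) ∣
      <⟨ +-mono-<
           (*-bound (x m) (y m - y n) 0<B (x≤B m (ℕP.m⊔n≤o⇒m≤o M₁ N₁ (fst p)))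
             (hy m n (ℕP.m⊔n≤o⇒n≤o M₂ N₂ (snd p)) (ℕP.m⊔n≤o⇒n≤o M₂ N₂ (snd q))))
           (*-bound (y n) (x m - x n) 0<C (y≤C n (ℕP.m⊔n≤o⇒n≤o M₁ N₁ (fst q)))
             (hx m n (ℕP.m⊔n≤o⇒m≤o M₂ N₂ (snd p)) (ℕP.m⊔n≤o⇒m≤o M₂ N₂ (snd q)))) ⟩
    B * δ + C * η
      ≡⟨ trans (cong (_+ C * η) Bδ≡) (cong (half ε +_) Cη≡) ⟩
    half ε + half ε
      ≡⟨ half+half ε ⟩
    ε ∎

infixl 6 _+ℝ_
infixl 7 _*ℝ_
infix  8 -ℝ_

fromℚ : ℚ → ℝ
fromℚ q = mkℝ (λ _ → q) (const-cauchy q)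

_+ℝ_ : ℝ → ℝ → ℝ
x +ℝ y = mkℝ (λ n → seq x n + seq y n) (+-cauchy (seq x) (seq y) (cauchy x) (cauchy y))

-ℝ_ : ℝ → ℝ
-ℝ x = mkℝ (λ n → - seq x n) (neg-cauchy (seq x) (cauchy x))

_*ℝ_ : ℝ → ℝ → ℝ
x *ℝ y = mkℝ (λ n → seq x n * seq y n) (*-cauchy (seq x) (seq y) (cauchy x) (cauchy y))

infix 6 _+i_
record ℂ : Set where
  constructor _+i_
  field
    re im : ℝ
open ℂ public

ℂ-rawRing : RawRing _ _
ℂ-rawRing = record
  { Carrier = ℂ
  ; _≈_     = λ z w → re z ≈ℝ re w × im z ≈ℝ im w
  ; _+_     = λ z w → (re z +ℝ re w) +i (im z +ℝ im w)
  ; _*_     = λ z w → (re z *ℝ re w +ℝ -ℝ (im z *ℝ im w))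
                   +i (re z *ℝ im w +ℝ im z *ℝ re w)
  ; -_      = λ z → (-ℝ re z) +i (-ℝ im z)
  ; 0#      = fromℚ 0ℚ +i fromℚ 0ℚ
  ; 1#      = fromℚ 1ℚ +i fromℚ 0ℚ
  }

-- Matrix equality is entrywise.
module SquareMatrix {c ℓ} (R : RawRing c ℓ) where
  private module R = RawRing R
  open RawMonoidDefs R.+-rawMonoid using (sum)

  Matrix : ℕ → Set c
  Matrix n = Fin n → Fin n → R.Carrier

  infix  4 _≈ᴹ_ _≉ᴹ_
  infixl 7 _*ᴹ_
  infix  8 -ᴹ_

  _≈ᴹ_ _≉ᴹ_ : ∀ {n} → Matrix n → Matrix n → Set ℓ
  A ≈ᴹ B = ∀ i j → A i j R.≈ B i j
  A ≉ᴹ B = ¬ (A ≈ᴹ B)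

  0ᴹ : ∀ {n} → Matrix n
  0ᴹ i j = R.0#

  -ᴹ_ : ∀ {n} → Matrix n → Matrix n
  (-ᴹ A) i j = R.- A i j

  _*ᴹ_ : ∀ {n} → Matrix n → Matrix n → Matrix n
  (A *ᴹ B) i j = sum (λ l → A i l R.* B l j)

open SquareMatrix ℂ-rawRing public

IsAnticommuting : ∀ {n k} → (Fin k → Matrix n) → Set
IsAnticommuting e = ∀ i j → i ≢ j → e i *ᴹ e j ≈ᴹ -ᴹ (e j *ᴹ e i)

HasFamily : ℕ → ℕ → Set
HasFamily n k =
  ∃[ e ] (IsAnticommuting {n} {k} e × (∀ i → e i *ᴹ e i ≉ᴹ 0ᴹ))

IsLargest : (ℕ → Set) → ℕ → Set
IsLargest P m = P m × (∀ k → P k → k ℕ.≤ m)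

-- α[ n ]≐ m is the relation "α(n) = m". The maximum cannot be given as a
-- function outright: its existence is part of what has to be proved.
α[_]≐_ : ℕ → ℕ → Set
α[ n ]≐ m = IsLargest (HasFamily n) m

{-# OPTIONS --safe #-}
module Submission where

-- Upper bound.  The matrices w with e i w = ± w e i for all i form a set Q which
-- is closed under products and contains every e i.  Let w = B C be a nonzero
-- element of Q of minimal rank d.  By minimality each e i acts on the image of w
-- either as zero or invertibly.
--  * If d = n, all e i are invertible.  Conjugation by the e l multiplies e i e j
--    by signs that determine {i , j}, so the products e i e j with i < j are
--    linearly independent and k (k - 1) / 2 ≤ n².
--  * If d < n and w² ≠ 0, the space is the direct sum of the image and the kernel
--    of w: the e i acting invertibly are counted on the image, the others vanish
--    there and are counted on the kernel, both by induction.
--  * If w² = 0, the e i with e i w = 0 satisfy e i e j = X i Y j, where the product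
--    passes through ker w / im w, of dimension n - 2d.  For generic u and v the
--    matrix M = (u e i e j v) has rank at most n - 2d, and M + Mᵀ is an invertible
--    diagonal matrix, so there are at most 2 (n - 2d) of them.
-- The conclusion k ≤ α(n) is decidable, so all of this may be argued inside a
-- double negation, where ℂ behaves as a discrete field.
--
-- Lower bound.  For n = m + 2 there is a family of 2m + 1 matrices with entries in
-- {0 , 1 , -1}; for n ≤ 4 blocks of (real) Pauli matrices do better.

open import Algebra.Bundles using (AbelianGroup; CommutativeRing)
open import Data.Empty using (⊥)
open import Data.Fin.Base as Fin using (Fin; zero; suc; combine; punchIn; punchOut; remQuot; splitAt; toℕ; _↑ˡ_; _↑ʳ_)
import Data.Fin.Properties as FinP
open import Data.Nat.Base as ℕ using (ℕ; zero; suc; z≤n; s≤s)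
open import Data.Nat.Induction using (<-rec)
import Data.Nat.Properties as ℕP
open import Data.Nat.Solver using () renaming (module +-*-Solver to ℕ-Solver)
open import Data.Product.Base as Product using (∃-syntax; Σ-syntax; _×_; _,_; proj₁; proj₂)
open import Data.Rational.Base as ℚ using (ℚ; 0ℚ; 1ℚ; ½; mkℚ)
import Data.Rational.Properties as ℚP
open import Data.Sum.Base using (_⊎_; inj₁; inj₂; [_,_]′)
open import Data.Vec.Functional using (_++_)
open import Data.Vec.Functional.Properties using (lookup-++ˡ; lookup-++ʳ)
open import Defs using (module SquareMatrix)
open import Function.Base using (id; _∘_)
open import Level as Level using (_⊔_)
open import Relation.Binary.PropositionalEquality as ≡ using (_≡_; _≢_)
open import Relation.Nullary using (¬_; Dec; yes; no; contradiction; ¬¬-excluded-middle; decidable-stable)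
open import Relation.Nullary.Decidable using (True; toWitness; ¬?; _→-dec_; _×-dec_)

-- Minimal rank takes the place of eigenspaces and irreducible subspaces: no eigenvalue is ever
-- extracted, so an infinite field of characteristic other than 2 suffices, and this is what
-- `ClassicalField` records. The three cases also account for the shape of the formula. In the
-- invertible case k (k - 1) / 2 ≤ n² gives exactly 3, 4, 6 for n = 2, 3, 4 and at most 2n - 3 from
-- n = 5 on; n = 1 is treated apart, since the count would allow k = 2 there. In the nilpotent case
-- α(d) ≤ 2d - 1 gives α(d) + 2 (n - 2d) ≤ 2n - 2d - 1 ≤ 2n - 3. In the direct sum case the two
-- bounds are added, so the claimed value has to be superadditive. The family for n = m + 2 meets
-- the nilpotent bound with d = 1: the 2m matrices other than the diagonal one kill a rank one w
-- with w² = 0, and the diagonal one acts invertibly on its image.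

_>>=_ : ∀ {a b} {A : Set a} {B : Set b} → ¬ ¬ A → (A → ¬ ¬ B) → ¬ ¬ B
(m >>= f) ¬b = m λ x → f x ¬b

return : ∀ {a} {A : Set a} → A → ¬ ¬ A
return x ¬x = ¬x x

-- Constructively the nonzero complex numbers need not be invertible and their
-- equality is not decidable; this is what survives up to double negation.
record ClassicalField c ℓ : Set (Level.suc (c ⊔ ℓ)) where
  field
    commutativeRing : CommutativeRing c ℓ
  open CommutativeRing commutativeRing using (_≈_; _+_; _*_; 0#; 1#; Carrier)
  field
    stable      : ∀ {x y} → ¬ ¬ (x ≈ y) → x ≈ y
    invert      : ∀ {x} → ¬ (x ≈ 0#) → ¬ ¬ (∃[ y ] x * y ≈ 1#)
    1+1≉0       : ¬ (1# + 1# ≈ 0#)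
    ν           : ℕ → Carrier
    ν-injective : ∀ {m n} → ν m ≈ ν n → m ≡ n

¬¬-∀Fin : ∀ {p n} {P : Fin n → Set p} → (∀ i → ¬ ¬ P i) → ¬ ¬ (∀ i → P i)
¬¬-∀Fin {n = ℕ.zero}  h = return λ ()
¬¬-∀Fin {n = ℕ.suc n} h = do
  p  ← h zero
  ps ← ¬¬-∀Fin (λ i → h (suc i))
  return λ { zero → p ; (suc i) → ps i }

-- Injections instead of subsets: the subfamilies are then `e ∘ f` and `e ∘ g`, indexed by `Fin`
-- again, and their separate bounds add up through `m+n≡k`.
record Partition {a b k} (P : Fin k → Set a) (Q : Fin k → Set b) : Set (a ⊔ b) where
  field
    {m n}       : ℕ
    m+n≡k       : m ℕ.+ n ≡ k
    f           : Fin m → Fin k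
    g           : Fin n → Fin k
    f-injective : ∀ {i j} → f i ≡ f j → i ≡ j
    g-injective : ∀ {i j} → g i ≡ g j → i ≡ j
    P-f         : ∀ i → P (f i)
    Q-g         : ∀ i → Q (g i)

partition : ∀ {a b k} {P : Fin k → Set a} {Q : Fin k → Set b} → (∀ i → P i ⊎ Q i) → Partition P Q
partition {k = zero} d = record
  { m+n≡k = ≡.refl ; f = id ; g = id ; f-injective = id ; g-injective = id ; P-f = λ () ; Q-g = λ () }
partition {k = suc k} d with d zero | partition (d ∘ suc)
... | inj₁ p | s = record
  { m+n≡k = ≡.cong suc m+n≡k
  ; f = λ { zero → zero ; (suc i) → suc (f i) }
  ; g = λ i → suc (g i)
  ; f-injective = λ { {zero} {zero} _ → ≡.refl ; {suc i} {suc j} eq → ≡.cong suc (f-injective (FinP.suc-injective eq)) }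
  ; g-injective = g-injective ∘ FinP.suc-injective
  ; P-f = λ { zero → p ; (suc i) → P-f i }
  ; Q-g = Q-g
  } where open Partition s
... | inj₂ q | s = record
  { m+n≡k = ≡.trans (ℕP.+-suc m n) (≡.cong suc m+n≡k)
  ; f = λ i → suc (f i)
  ; g = λ { zero → zero ; (suc i) → suc (g i) }
  ; f-injective = f-injective ∘ FinP.suc-injective
  ; g-injective = λ { {zero} {zero} _ → ≡.refl ; {suc i} {suc j} eq → ≡.cong suc (g-injective (FinP.suc-injective eq)) }
  ; P-f = P-f
  ; Q-g = λ { zero → q ; (suc i) → Q-g i }
  } where open Partition s

-- Arithmetic of the claimed value, and pairs of indices

module Arithmetic where
  open import Data.Fin.Properties using (all?; toℕ-fromℕ<)
  open import Data.Nat.Base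
  open import Data.Nat.Properties
  open import Relation.Binary.PropositionalEquality using (refl; sym; trans; cong; cong₂; subst; subst₂)

  -- The last clause is 2n - 3 for n = 5 + m, free of truncated subtraction. The value at 0 is there
  -- because the induction is applied to arbitrary smaller dimensions.
  α-value : ℕ → ℕ
  α-value 0 = 0
  α-value 1 = 1
  α-value 2 = 3
  α-value 3 = 4
  α-value 4 = 6
  α-value (suc (suc (suc (suc (suc m))))) = 7 + (m + m)

  α-value-mono : ∀ {m n} → m ≤ n → α-value m ≤ α-value n
  α-value-mono m≤n = go (≤⇒≤′ m≤n)
    where
    step : ∀ n → α-value n ≤ α-value (suc n)
    step 0 = z≤n
    step 1 = s≤s z≤n
    step 2 = s≤s (s≤s (s≤s z≤n))
    step 3 = s≤s (s≤s (s≤s (s≤s z≤n)))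
    step 4 = n≤1+n 6
    step (suc (suc (suc (suc (suc m))))) = +-monoʳ-≤ 7 (+-mono-≤ (n≤1+n m) (n≤1+n m))
    go : ∀ {m n} → m ≤′ n → α-value m ≤ α-value n
    go ≤′-refl       = ≤-refl
    go (≤′-step {n} p) = ≤-trans (go p) (step n)

  -- Together with `α-value<n+n` this places the value between 2n - 3 and 2n - 1, the only
  -- information on it that the nilpotent case uses.
  n+n≤α-value+3 : ∀ n → n + n ≤ α-value n + 3
  n+n≤α-value+3 0 = z≤n
  n+n≤α-value+3 1 = toWitness {a? = 2 ≤? 4} _
  n+n≤α-value+3 2 = toWitness {a? = 4 ≤? 6} _
  n+n≤α-value+3 3 = toWitness {a? = 6 ≤? 7} _
  n+n≤α-value+3 4 = toWitness {a? = 8 ≤? 9} _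
  n+n≤α-value+3 (suc (suc (suc (suc (suc m))))) = ≤-reflexive
    (solve 1 (λ m → con 5 :+ m :+ (con 5 :+ m) := con 7 :+ (m :+ m) :+ con 3) refl m)
    where open ℕ-Solver

  α-value<n+n : ∀ n → 1 ≤ n → α-value n < n + n
  α-value<n+n 1 _ = toWitness {a? = 2 ≤? 2} _
  α-value<n+n 2 _ = toWitness {a? = 4 ≤? 4} _
  α-value<n+n 3 _ = toWitness {a? = 5 ≤? 6} _
  α-value<n+n 4 _ = toWitness {a? = 7 ≤? 8} _
  α-value<n+n (suc (suc (suc (suc (suc m))))) _ = ≤-trans (m≤m+n _ 2) (≤-reflexive
    (solve 1 (λ m → con 8 :+ (m :+ m) :+ con 2 := con 5 :+ m :+ (con 5 :+ m)) refl m))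
    where open ℕ-Solver

  α-value≤n+n : ∀ n → α-value n ≤ n + n
  α-value≤n+n zero      = z≤n
  α-value≤n+n n@(suc _) = <⇒≤ (α-value<n+n n (s≤s z≤n))

  -- Once one argument is at least 5, so is the sum: the deficit 3 against 2n is then charged to
  -- that argument, and the other one is bounded by twice itself. The remaining 25 cases are
  -- computed.
  α-value-superadditive : ∀ m n → α-value m + α-value n ≤ α-value (m + n)
  α-value-superadditive m n with m <? 5 | n <? 5
  ... | yes m<5 | yes n<5 =
    subst₂ (λ m n → α-value m + α-value n ≤ α-value (m + n)) (toℕ-fromℕ< m<5) (toℕ-fromℕ< n<5)
      (toWitness {a? = all? λ (i : Fin 5) → all? λ (j : Fin 5) →
        α-value (toℕ i) + α-value (toℕ j) ≤? α-value (toℕ i + toℕ j)} _ (Fin.fromℕ< m<5) (Fin.fromℕ< n<5))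
  ... | no m≮5 | _ = subst (λ m → α-value m + α-value n ≤ α-value (m + n)) (m+[n∸m]≡n (≮⇒≥ m≮5)) (large (m ∸ 5) n)
    where
    large : ∀ m n → α-value (5 + m) + α-value n ≤ α-value (5 + m + n)
    large m n = ≤-trans (+-monoʳ-≤ (7 + (m + m)) (α-value≤n+n n)) (≤-reflexive
      (solve 2 (λ m n → con 7 :+ (m :+ m) :+ (n :+ n) := con 7 :+ (m :+ n :+ (m :+ n))) refl m n))
      where open ℕ-Solver
  ... | _ | no n≮5 = subst (λ n → α-value m + α-value n ≤ α-value (m + n)) (m+[n∸m]≡n (≮⇒≥ n≮5)) (large (n ∸ 5))
    where
    large : ∀ n → α-value m + α-value (5 + n) ≤ α-value (m + (5 + n))
    large n = ≤-trans (+-monoˡ-≤ (7 + (n + n)) (α-value≤n+n m)) (≤-reflexive (trans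
      (solve 2 (λ m n → m :+ m :+ (con 7 :+ (n :+ n)) := con 7 :+ (m :+ n :+ (m :+ n))) refl m n)
      (cong α-value (solve 2 (λ m n → con 5 :+ (m :+ n) := m :+ (con 5 :+ n)) refl m n))))
      where open ℕ-Solver

  α-value-split : ∀ {m n k} → m + n ≤ k → α-value m + α-value n ≤ α-value k
  α-value-split {m} {n} h = ≤-trans (α-value-superadditive m n) (α-value-mono h)

  -- The left side falls short of 2n by at least 3: one from α(d) < 2d, and two because 2 (2d + r)
  -- exceeds 2d + 2r by 2d ≥ 2.
  α-value-nilpotent : ∀ {d r n} → 1 ≤ d → (d + d) + r ≤ n → α-value d + (r + r) ≤ α-value n
  α-value-nilpotent {d} {r} {n} 1≤d h = +-cancelʳ-≤ 3 _ _ (begin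
    α-value d + (r + r) + 3        ≡⟨ solve 2 (λ a r → a :+ (r :+ r) :+ con 3 := con 1 :+ a :+ (r :+ r :+ con 2)) refl (α-value d) r ⟩
    suc (α-value d) + (r + r + 2)  ≤⟨ +-mono-≤ (α-value<n+n d 1≤d) (+-monoʳ-≤ (r + r) (+-mono-≤ 1≤d 1≤d)) ⟩
    d + d + (r + r + (d + d))      ≡⟨ solve 2 (λ d r → d :+ d :+ (r :+ r :+ (d :+ d)) := d :+ d :+ r :+ (d :+ d :+ r)) refl d r ⟩
    d + d + r + (d + d + r)        ≤⟨ +-mono-≤ h h ⟩
    n + n                          ≤⟨ n+n≤α-value+3 n ⟩
    α-value n + 3                  ∎)
    where
    open ≤-Reasoning
    open ℕ-Solver

  -- The binomial coefficient k (k - 1) / 2, in the recursion that `pair` follows: k pairs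
  -- containing the first index, then the pairs among the others.
  tri : ℕ → ℕ
  tri zero    = 0
  tri (suc k) = k + tri k

  tri-mono : ∀ {m n} → m ≤ n → tri m ≤ tri n
  tri-mono z≤n       = z≤n
  tri-mono (s≤s m≤n) = +-mono-≤ m≤n (tri-mono m≤n)

  -- For n = 2, 3, 4 the index `suc (α-value n)` is the first at which `tri` passes n². From 5 on, a
  -- step adds 11 + 2m on the left and 17 + 4m on the right. At n = 1 it fails, as `tri 2` is 1.
  n*n<tri : ∀ n → 2 ≤ n → n * n < tri (suc (α-value n))
  n*n<tri 1 (s≤s ())
  n*n<tri 2 _ = toWitness {a? = 5 ≤? 6} _
  n*n<tri 3 _ = toWitness {a? = 10 ≤? 10} _
  n*n<tri 4 _ = toWitness {a? = 17 ≤? 21} _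
  n*n<tri (suc (suc (suc (suc (suc m))))) _ = go m
    where
    open ℕ-Solver
    go : ∀ m → (5 + m) * (5 + m) < tri (8 + (m + m))
    go zero    = toWitness {a? = 26 ≤? 28} _
    go (suc m) = begin-strict
      (6 + m) * (6 + m)                                  ≡⟨ solve 1 (λ m → (con 6 :+ m) :* (con 6 :+ m) := (con 5 :+ m) :* (con 5 :+ m) :+ (con 11 :+ (m :+ m))) refl m ⟩
      (5 + m) * (5 + m) + (11 + (m + m))                 <⟨ +-monoˡ-< (11 + (m + m)) (go m) ⟩
      tri (8 + (m + m)) + (11 + (m + m))                 ≤⟨ m≤m+n _ (6 + (m + m)) ⟩
      tri (8 + (m + m)) + (11 + (m + m)) + (6 + (m + m)) ≡⟨ solve 2 (λ m t → t :+ (con 11 :+ (m :+ m)) :+ (con 6 :+ (m :+ m)) := con 9 :+ (m :+ m) :+ (con 8 :+ (m :+ m) :+ t)) refl m (tri (8 + (m + m))) ⟩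
      tri (10 + (m + m))                                 ≡⟨ cong (λ x → tri (9 + x)) (sym (+-suc m m)) ⟩
      tri (8 + (suc m + suc m))                          ∎
      where open ≤-Reasoning

  tri≤n*n⇒≤α-value : ∀ {k n} → 2 ≤ n → tri k ≤ n * n → k ≤ α-value n
  tri≤n*n⇒≤α-value {k} {n} 2≤n h = ≮⇒≥ λ α<k →
    <⇒≱ (n*n<tri n 2≤n) (≤-trans (tri-mono α<k) h)

  pair : ∀ k → Fin (tri k) → Fin k × Fin k
  pair (suc k) s = [ (λ j → zero , suc j) , Product.map suc suc ∘ pair k ]′ (splitAt k s)

  pair-< : ∀ k s → proj₁ (pair k s) Fin.< proj₂ (pair k s)
  pair-< (suc k) s with splitAt k s
  ... | inj₁ j = s≤s z≤n
  ... | inj₂ s = s≤s (pair-< k s)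

  pair-injective : ∀ k {s t} → pair k s ≡ pair k t → s ≡ t
  pair-injective (suc k) {s} {t} eq = trans (sym (FinP.join-splitAt k (tri k) s))
    (trans (cong (Fin.join k (tri k)) (go (splitAt k s) (splitAt k t) eq)) (FinP.join-splitAt k (tri k) t))
    where
    entry : Fin k ⊎ Fin (tri k) → Fin (suc k) × Fin (suc k)
    entry = [ (λ j → zero , suc j) , Product.map suc suc ∘ pair k ]′
    go : ∀ x y → entry x ≡ entry y → x ≡ y
    go (inj₁ i) (inj₁ j) e = cong inj₁ (FinP.suc-injective (cong proj₂ e))
    go (inj₁ i) (inj₂ t) e with () ← cong proj₁ e
    go (inj₂ s) (inj₁ j) e with () ← cong proj₁ e
    go (inj₂ s) (inj₂ t) e = cong inj₂ (pair-injective k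
      (cong₂ _,_ (FinP.suc-injective (cong proj₁ e)) (FinP.suc-injective (cong proj₂ e))))

-- Rectangular matrices over a commutative ring

module Matrices {c ℓ} (R : CommutativeRing c ℓ) where
  open CommutativeRing R public hiding (zero)
  open import Algebra.Properties.Ring ring public
    using (-‿distribˡ-*; -‿distribʳ-*; -‿involutive; -0#≈0#; -‿+-comm)
  open import Algebra.Properties.Semiring.Sum semiring public
    using (sum; sum-cong-≋; sum-replicate-zero; ∑-distrib-+; ∑-comm; *-distribˡ-sum; *-distribʳ-sum; sum-remove)

  Mat : ℕ → ℕ → Set c
  Mat m n = Fin m → Fin n → Carrier

  private variable
    k l m n p q : ℕ

  infix 4 _≋_
  -- A record, so that the two matrices can be recovered from the type by unification; a bare
  -- pointwise equation would unfold and lose them.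
  record _≋_ {m n} (A B : Mat m n) : Set ℓ where
    constructor entries
    field entry : ∀ i j → A i j ≈ B i j
  open _≋_ public

  infixl 6 _⊕_
  infixr 7 _·_
  infix  8 ⊖_
  infixr 5 _▹_ _▿_ _∣_
  infix  9 _ᵀ

  𝟎 : Mat m n
  𝟎 _ _ = 0#

  -- Recursive, without a decision of i = j, so that the block form `𝟏-block` holds entry by entry
  -- by `refl`.
  𝟏 : Mat n n
  𝟏 zero    zero    = 1#
  𝟏 zero    (suc j) = 0#
  𝟏 (suc i) zero    = 0#
  𝟏 (suc i) (suc j) = 𝟏 i j

  _⊕_ : Mat m n → Mat m n → Mat m n
  (A ⊕ B) i j = A i j + B i j

  ⊖_ : Mat m n → Mat m n
  (⊖ A) i j = - A i j

  _▹_ : Mat m 1 → Mat m n → Mat m (suc n)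
  (a ▹ A) i zero    = a i zero
  (a ▹ A) i (suc j) = A i j

  _▿_ : Mat 1 n → Mat m n → Mat (suc m) n
  (a ▿ A) zero    j = a zero j
  (a ▿ A) (suc i) j = A i j

  _∣_ : Mat m n → Mat m p → Mat m (n ℕ.+ p)
  (A ∣ B) i = A i ++ B i

  _ᵀ : Mat m n → Mat n m
  (A ᵀ) i j = A j i

  opaque
    -- Opaque to keep products from unfolding into sums: factors stay inferable, and entries are
    -- reached only through `·-entry`.
    _·_ : Mat m n → Mat n p → Mat m p
    (A · B) i j = sum (λ l → A i l * B l j)

  ⊕-abelianGroup : ℕ → ℕ → AbelianGroup c ℓ
  ⊕-abelianGroup m n = record
    { Carrier = Mat m n
    ; _≈_ = _≋_
    ; _∙_ = _⊕_
    ; ε = 𝟎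
    ; _⁻¹ = ⊖_
    ; isAbelianGroup = record
      { isGroup = record
        { isMonoid = record
          { isSemigroup = record
            { isMagma = record
              { isEquivalence = record
                { refl  = entries λ _ _ → refl
                ; sym   = λ e → entries λ i j → sym (entry e i j)
                ; trans = λ e f → entries λ i j → trans (entry e i j) (entry f i j)
                }
              ; ∙-cong = λ e f → entries λ i j → +-cong (entry e i j) (entry f i j)
              }
            ; assoc = λ _ _ _ → entries λ _ _ → +-assoc _ _ _
            }
          ; identity = (λ _ → entries λ _ _ → +-identityˡ _) , (λ _ → entries λ _ _ → +-identityʳ _)
          }
        ; inverse = (λ _ → entries λ _ _ → -‿inverseˡ _) , (λ _ → entries λ _ _ → -‿inverseʳ _)
        ; ⁻¹-cong = λ e → entries λ i j → -‿cong (entry e i j)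
        }
      ; comm = λ _ _ → entries λ _ _ → +-comm _ _
      }
    }

  module _ {m n : ℕ} where
    open AbelianGroup (⊕-abelianGroup m n) public using () renaming
      ( refl to ≋-refl; sym to ≋-sym; trans to ≋-trans; ∙-cong to ⊕-cong
      ; ∙-congˡ to ⊕-congˡ; ∙-congʳ to ⊕-congʳ; ⁻¹-cong to ⊖-cong
      ; identityˡ to ⊕-identityˡ; identityʳ to ⊕-identityʳ
      ; inverseˡ to ⊕-inverseˡ; inverseʳ to ⊕-inverseʳ; assoc to ⊕-assoc; comm to ⊕-comm)
    open import Algebra.Properties.AbelianGroup (⊕-abelianGroup m n) public using () renaming
      ( ⁻¹-involutive to ⊖-involutive; ε⁻¹≈ε to ⊖-𝟎; ⁻¹-∙-comm to ⊖-⊕-comm)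
    open import Relation.Binary.Reasoning.Setoid (AbelianGroup.setoid (⊕-abelianGroup m n)) public

  sum-zero : ∀ {n} {f : Fin n → Carrier} → (∀ i → f i ≈ 0#) → sum f ≈ 0#
  sum-zero {n} h = trans (sum-cong-≋ h) (sum-replicate-zero n)

  sum-single : ∀ {n} {f : Fin n → Carrier} i → (∀ j → j ≢ i → f j ≈ 0#) → sum f ≈ f i
  sum-single {suc n} {f} i h = trans (sum-remove f)
    (trans (+-congˡ (sum-zero λ j → h _ (λ eq → FinP.punchInᵢ≢i i j eq))) (+-identityʳ (f i)))

  sum-neg : ∀ {n} (f : Fin n → Carrier) → - sum f ≈ sum (λ i → - f i)
  sum-neg {zero}  f = -0#≈0#
  sum-neg {suc n} f = trans (sym (-‿+-comm _ _)) (+-congˡ (sum-neg (λ i → f (suc i))))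

  sum-++ : ∀ {m n} (f : Fin m → Carrier) (g : Fin n → Carrier) → sum (f ++ g) ≈ sum f + sum g
  sum-++ {zero}  f g = sym (+-identityˡ _)
  sum-++ {suc m} {n} f g = trans (+-congˡ (trans (sum-cong-≋ shift) (sum-++ (λ i → f (suc i)) g))) (sym (+-assoc _ _ _))
    where
    shift : ∀ i → (f ++ g) (suc i) ≈ ((λ i → f (suc i)) ++ g) i
    shift i with splitAt m i
    ... | inj₁ _ = refl
    ... | inj₂ _ = refl

  opaque
    unfolding _·_

    ·-entry : (A : Mat m n) (B : Mat n p) → ∀ i j → (A · B) i j ≡ sum (λ l → A i l * B l j)
    ·-entry A B i j = ≡.refl

    ·-rows : (f : Fin k → Fin m) (A : Mat m n) (B : Mat n p) → (λ i → A (f i)) · B ≋ (λ i → (A · B) (f i))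
    ·-rows f A B = entries λ _ _ → refl

    ·-cong : {A A′ : Mat m n} {B B′ : Mat n p} → A ≋ A′ → B ≋ B′ → A · B ≋ A′ · B′
    ·-cong e f = entries λ i j → sum-cong-≋ λ l → *-cong (entry e i l) (entry f l j)

    ·-assoc : (A : Mat m n) (B : Mat n p) (C : Mat p q) → (A · B) · C ≋ A · B · C
    ·-assoc A B C = entries λ i j →
      trans (sum-cong-≋ λ l → trans (*-distribʳ-sum (C l j) (λ k → A i k * B k l))
                                    (sum-cong-≋ λ k → *-assoc (A i k) (B k l) (C l j)))
      (trans (∑-comm λ l k → A i k * (B k l * C l j))
        (sum-cong-≋ λ k → sym (*-distribˡ-sum (A i k) (λ l → B k l * C l j))))

    ·-distribˡ : (A : Mat m n) (B C : Mat n p) → A · (B ⊕ C) ≋ A · B ⊕ A · C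
    ·-distribˡ A B C = entries λ i j →
      trans (sum-cong-≋ λ l → distribˡ (A i l) (B l j) (C l j))
            (∑-distrib-+ (λ l → A i l * B l j) (λ l → A i l * C l j))

    ·-distribʳ : (C : Mat n p) (A B : Mat m n) → (A ⊕ B) · C ≋ A · C ⊕ B · C
    ·-distribʳ C A B = entries λ i j →
      trans (sum-cong-≋ λ l → distribʳ (C l j) (A i l) (B i l))
            (∑-distrib-+ (λ l → A i l * C l j) (λ l → B i l * C l j))

    ·-zeroˡ : (A : Mat n p) → 𝟎 {m} · A ≋ 𝟎
    ·-zeroˡ A = entries λ i j → sum-zero λ l → zeroˡ (A l j)

    ·-zeroʳ : (A : Mat m n) → A · 𝟎 {n} {p} ≋ 𝟎
    ·-zeroʳ A = entries λ i j → sum-zero λ l → zeroʳ (A i l)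

    ⊖-·ˡ : (A : Mat m n) (B : Mat n p) → (⊖ A) · B ≋ ⊖ (A · B)
    ⊖-·ˡ A B = entries λ i j → sym (trans (sum-neg (λ l → A i l * B l j)) (sum-cong-≋ λ l → -‿distribˡ-* (A i l) (B l j)))

    ⊖-·ʳ : (A : Mat m n) (B : Mat n p) → A · (⊖ B) ≋ ⊖ (A · B)
    ⊖-·ʳ A B = entries λ i j → sym (trans (sum-neg (λ l → A i l * B l j)) (sum-cong-≋ λ l → -‿distribʳ-* (A i l) (B l j)))

    𝟏-row : (i : Fin n) (f : Fin n → Carrier) → sum (λ l → 𝟏 i l * f l) ≈ f i
    𝟏-row zero    f = trans (+-cong (*-identityˡ _) (sum-zero {f = λ l → 0# * f (suc l)} λ l → zeroˡ _)) (+-identityʳ _)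
    𝟏-row (suc i) f = trans (+-cong (zeroˡ _) (𝟏-row i (λ l → f (suc l)))) (+-identityˡ _)

    𝟏-diagonal : (i : Fin n) → 𝟏 i i ≈ 1#
    𝟏-diagonal zero    = refl
    𝟏-diagonal (suc i) = 𝟏-diagonal i

    𝟏-off-diagonal : (i j : Fin n) → i ≢ j → 𝟏 i j ≈ 0#
    𝟏-off-diagonal zero    zero    i≢j = contradiction ≡.refl i≢j
    𝟏-off-diagonal zero    (suc j) i≢j = refl
    𝟏-off-diagonal (suc i) zero    i≢j = refl
    𝟏-off-diagonal (suc i) (suc j) i≢j = 𝟏-off-diagonal i j (i≢j ∘ ≡.cong suc)

    𝟏-sym : (i j : Fin n) → 𝟏 i j ≡ 𝟏 j i
    𝟏-sym zero    zero    = ≡.refl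
    𝟏-sym zero    (suc j) = ≡.refl
    𝟏-sym (suc i) zero    = ≡.refl
    𝟏-sym (suc i) (suc j) = 𝟏-sym i j

    ·-identityˡ : (A : Mat m n) → 𝟏 · A ≋ A
    ·-identityˡ A = entries λ i j → 𝟏-row i (λ l → A l j)

    ·-identityʳ : (A : Mat m n) → A · 𝟏 ≋ A
    ·-identityʳ A = entries λ i j →
      trans (sum-cong-≋ λ l → trans (*-comm (A i l) (𝟏 l j)) (*-congʳ (reflexive (𝟏-sym l j)))) (𝟏-row j (A i))

    ▹·▿ : (a : Mat m 1) (A : Mat m n) (b : Mat 1 p) (B : Mat n p) → (a ▹ A) · (b ▿ B) ≋ a · b ⊕ A · B
    ▹·▿ a A b B = entries λ i j → +-congʳ (sym (+-identityʳ _))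

    ·-▹ : (X : Mat p m) (a : Mat m 1) (A : Mat m n) → X · (a ▹ A) ≋ X · a ▹ X · A
    ·-▹ X a A = entries λ { i zero → refl ; i (suc j) → refl }

    ▿-· : (a : Mat 1 n) (A : Mat m n) (X : Mat n p) → (a ▿ A) · X ≋ a · X ▿ A · X
    ▿-· a A X = entries λ { zero j → refl ; (suc i) j → refl }

    ∣·++ : (A : Mat m n) (B : Mat m p) (a : Mat n q) (b : Mat p q) →
            (A ∣ B) · (a ++ b) ≋ A · a ⊕ B · b
    ∣·++ {n = n} {p = p} A B a b = entries λ i j →
      trans (sum-cong-≋ (λ l → split i j l)) (sum-++ (λ l → A i l * a l j) (λ l → B i l * b l j))
      where
      split : ∀ i j l → (A i ++ B i) l * (a ++ b) l j ≈ ((λ l → A i l * a l j) ++ (λ l → B i l * b l j)) l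
      split i j l with splitAt n l
      ... | inj₁ _ = refl
      ... | inj₂ _ = refl

    ·-∣ : (X : Mat p m) (A : Mat m n) (B : Mat m q) → X · (A ∣ B) ≋ (X · A) ∣ (X · B)
    ·-∣ {n = n} X A B = entries go
      where
      go : ∀ i j → (X · (A ∣ B)) i j ≈ ((X · A) ∣ (X · B)) i j
      go i j with splitAt n j
      ... | inj₁ _ = refl
      ... | inj₂ _ = refl

    ·-ᵀ : (A : Mat m n) (B : Mat n p) → (A · B) ᵀ ≋ B ᵀ · A ᵀ
    ·-ᵀ A B = entries λ i j → sum-cong-≋ λ l → *-comm (A j l) (B l i)

  ᵀ-cong : {A B : Mat m n} → A ≋ B → A ᵀ ≋ B ᵀ
  ᵀ-cong e = entries λ i j → entry e j i

  ∣-cong : {A A′ : Mat m n} {B B′ : Mat m p} → A ≋ A′ → B ≋ B′ → A ∣ B ≋ A′ ∣ B′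
  ∣-cong {n = n} {A = A} {A′} {B} {B′} e f = entries go
    where
    go : ∀ i j → (A ∣ B) i j ≈ (A′ ∣ B′) i j
    go i j with splitAt n j
    ... | inj₁ x = entry e i x
    ... | inj₂ x = entry f i x

  ▹-cong : {a b : Mat m 1} {A B : Mat m n} → a ≋ b → A ≋ B → a ▹ A ≋ b ▹ B
  ▹-cong e f = entries λ { i zero → entry e i zero ; i (suc j) → entry f i j }

  ▿-cong : {a b : Mat 1 n} {A B : Mat m n} → a ≋ b → A ≋ B → a ▿ A ≋ b ▿ B
  ▿-cong e f = entries λ { zero j → entry e zero j ; (suc i) j → entry f i j }

  ++-η : (c : Mat (m ℕ.+ n) p) → c ≋ (λ i → c (i ↑ˡ n)) ++ (λ i → c (m ↑ʳ i))
  ++-η {m} {n} c = entries go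
    where
    go : ∀ i j → c i j ≈ ((λ i → c (i ↑ˡ n)) ++ (λ i → c (m ↑ʳ i))) i j
    go i j with splitAt m i | FinP.join-splitAt m n i
    ... | inj₁ x | ≡.refl = refl
    ... | inj₂ x | ≡.refl = refl

  ++-≋𝟎 : {a : Mat m p} {b : Mat n p} → a ≋ 𝟎 → b ≋ 𝟎 → a ++ b ≋ 𝟎
  ++-≋𝟎 {m} {a = a} {b} e f = entries go
    where
    go : ∀ i j → (a ++ b) i j ≈ 0#
    go i j with splitAt m i
    ... | inj₁ x = entry e x j
    ... | inj₂ x = entry f x j

  ∣-injective : (A : Mat m n) (B : Mat m p) →
    (∀ c₁ c₂ → A · c₁ ⊕ B · c₂ ≋ 𝟎 → c₁ ≋ 𝟎 × c₂ ≋ 𝟎) →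
    ∀ (c : Mat (n ℕ.+ p) 1) → (A ∣ B) · c ≋ 𝟎 → c ≋ 𝟎
  ∣-injective {n = n} {p = p} A B inj c h = ≋-trans split (++-≋𝟎 (proj₁ zeros) (proj₂ zeros))
    where
    split : c ≋ (λ i → c (i ↑ˡ p)) ++ (λ i → c (n ↑ʳ i))
    split = ++-η {m = n} c
    zeros = inj _ _ (≋-trans (≋-sym (∣·++ A B _ _)) (≋-trans (·-cong ≋-refl (≋-sym split)) h))

  ▹-η : (A : Mat m (suc n)) → A ≋ (λ i _ → A i zero) ▹ (λ i j → A i (suc j))
  ▹-η A = entries λ { i zero → refl ; i (suc j) → refl }

  𝟏-block : 𝟏 {suc n} ≋ (𝟏 ▹ 𝟎) ▿ (𝟎 ▹ 𝟏)
  𝟏-block = entries λ { zero zero → refl ; zero (suc j) → refl ; (suc i) zero → refl ; (suc i) (suc j) → refl }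

  ·-congˡ : {A : Mat m n} {B B′ : Mat n p} → B ≋ B′ → A · B ≋ A · B′
  ·-congˡ = ·-cong ≋-refl

  ·-congʳ : {B : Mat n p} {A A′ : Mat m n} → A ≋ A′ → A · B ≋ A′ · B
  ·-congʳ e = ·-cong e ≋-refl

-- Upper bound: cancellation and dimension counts

module UpperBound {c ℓ} (F : ClassicalField c ℓ) where
  open Arithmetic
  open ClassicalField F
  open Matrices commutativeRing
  open import Data.Nat.Base using (_≤_; _<_)

  private variable
    k m n p : ℕ

  1≉0 : ¬ (1# ≈ 0#)
  1≉0 1≈0 = 1+1≉0 (trans (+-cong 1≈0 1≈0) (+-identityˡ 0#))

  -- The inverse of x is available only up to double negation; stability of the equation to be
  -- proved absorbs this.
  x*y≈0⇒y≈0 : ∀ {x y} → ¬ (x ≈ 0#) → x * y ≈ 0# → y ≈ 0#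
  x*y≈0⇒y≈0 {x} {y} x≉0 xy≈0 = stable do
    (z , xz≈1) ← invert x≉0
    return (trans (sym (*-identityˡ y)) (trans (*-congʳ (trans (sym xz≈1) (*-comm x z)))
           (trans (*-assoc z x y) (trans (*-congˡ xy≈0) (zeroʳ z)))))

  x+x≈0⇒x≈0 : ∀ {x} → x + x ≈ 0# → x ≈ 0#
  x+x≈0⇒x≈0 {x} e = x*y≈0⇒y≈0 1+1≉0
    (trans (distribʳ x 1# 1#) (trans (+-cong (*-identityˡ x) (*-identityˡ x)) e))

  ≋-stable : {A B : Mat m n} → ¬ ¬ (A ≋ B) → A ≋ B
  ≋-stable h = entries λ i j → stable λ ¬e → h λ e → ¬e (entry e i j)

  A⊕A≋𝟎⇒A≋𝟎 : {A : Mat m n} → A ⊕ A ≋ 𝟎 → A ≋ 𝟎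
  A⊕A≋𝟎⇒A≋𝟎 e = entries λ i j → x+x≈0⇒x≈0 (entry e i j)

  nonzero-entry : {A : Mat m n} → ¬ (A ≋ 𝟎) → ¬ ¬ (∃[ i ] ∃[ j ] ¬ (A i j ≈ 0#))
  nonzero-entry A≉0 ¬∃ = A≉0 (entries λ i j → stable λ h → ¬∃ (i , j , h))

  cancelˡ : {X : Mat p m} {B : Mat m p} → X · B ≋ 𝟏 → (Y : Mat p n) → X · B · Y ≋ Y
  cancelˡ {X = X} {B} e Y = ≋-trans (≋-sym (·-assoc X B Y)) (≋-trans (·-congʳ e) (·-identityˡ Y))

  injectiveˡ : {X : Mat p m} {B : Mat m p} → X · B ≋ 𝟏 → {Y Z : Mat p n} → B · Y ≋ B · Z → Y ≋ Z
  injectiveˡ e {Y} {Z} h = ≋-trans (≋-sym (cancelˡ e Y)) (≋-trans (·-congˡ h) (cancelˡ e Z))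

  injectiveˡ-𝟎 : {X : Mat p m} {B : Mat m p} → X · B ≋ 𝟏 → {Y : Mat p n} → B · Y ≋ 𝟎 → Y ≋ 𝟎
  injectiveˡ-𝟎 {B = B} e h = injectiveˡ e (≋-trans h (≋-sym (·-zeroʳ B)))

  injectiveʳ : {C : Mat p m} {X : Mat m p} → C · X ≋ 𝟏 → {Y Z : Mat n p} → Y · C ≋ Z · C → Y ≋ Z
  injectiveʳ {C = C} {X} e {Y} {Z} h = ≋-trans (≋-sym (undo Y)) (≋-trans (·-congʳ h) (undo Z))
    where
    undo : ∀ Y → (Y · C) · X ≋ Y
    undo Y = ≋-trans (·-assoc Y C X) (≋-trans (·-congˡ e) (·-identityʳ Y))

  injectiveʳ-𝟎 : {C : Mat p m} {X : Mat m p} → C · X ≋ 𝟏 → {Y : Mat n p} → Y · C ≋ 𝟎 → Y ≋ 𝟎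
  injectiveʳ-𝟎 {C = C} e h = injectiveʳ e (≋-trans h (≋-sym (·-zeroˡ C)))

  -- Gaussian elimination. Column zero has a nonzero entry, since otherwise the first basis vector
  -- would be in the kernel. The pivot is found under a double negation, which is harmless because ≤
  -- on ℕ is decidable. All rank and dimension inequalities below come from here.
  injective⇒≤ : (A : Mat m n) → (∀ (c : Mat n 1) → A · c ≋ 𝟎 → c ≋ 𝟎) → n ≤ m
  injective⇒≤ {n = zero}  A inj = z≤n
  injective⇒≤ {m} {suc n} A inj = decidable-stable (suc n ℕP.≤? m) do
    (i , zero , aᵢ≉0) ← nonzero-entry a₀≉0
    (b , aᵢb≈1)       ← invert aᵢ≉0
    return (eliminate A inj i b aᵢb≈1)
    where
    a₀ : Mat m 1
    a₀ i _ = A i zero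

    a₀≉0 : ¬ (a₀ ≋ 𝟎)
    a₀≉0 a₀≋0 = 1≉0 (entry (inj (𝟏 ▿ 𝟎) (begin
      A · (𝟏 ▿ 𝟎)                              ≈⟨ ·-congʳ (▹-η A) ⟩
      (a₀ ▹ (λ i j → A i (suc j))) · (𝟏 ▿ 𝟎)    ≈⟨ ▹·▿ a₀ _ 𝟏 𝟎 ⟩
      a₀ · 𝟏 ⊕ (λ i j → A i (suc j)) · 𝟎        ≈⟨ ⊕-cong (·-identityʳ a₀) (·-zeroʳ _) ⟩
      a₀ ⊕ 𝟎                                    ≈⟨ ⊕-identityʳ a₀ ⟩
      a₀                                        ≈⟨ a₀≋0 ⟩
      𝟎                                        ∎)) zero zero)

    -- Clearing row i against the pivot leaves an injective matrix with one row
    -- and one column less.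
    eliminate : ∀ {m n} (A : Mat m (suc n)) → (∀ c → A · c ≋ 𝟎 → c ≋ 𝟎) →
                ∀ i b → A i zero * b ≈ 1# → suc n ≤ m
    eliminate {suc m} {n} A inj i b aᵢb≈1 = s≤s (injective⇒≤ (λ l → D (punchIn i l)) inj′)
      where
      a : Mat (suc m) 1
      a i _ = A i zero
      A₁ : Mat (suc m) n
      A₁ i j = A i (suc j)
      r : Mat 1 n
      r _ j = b * A₁ i j
      D : Mat (suc m) n
      D = A₁ ⊕ ⊖ (a · r)

      Dᵢ≈0 : ∀ j → D i j ≈ 0#
      Dᵢ≈0 j = trans (+-congˡ (-‿cong (trans (reflexive (·-entry a r i j)) (trans (+-identityʳ _)
        (trans (sym (*-assoc _ _ _)) (trans (*-congʳ aᵢb≈1) (*-identityˡ _))))))) (-‿inverseʳ _)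

      inj′ : ∀ c → (λ l → D (punchIn i l)) · c ≋ 𝟎 → c ≋ 𝟎
      -- A kernel vector c of the reduced matrix is completed to one of A by solving row i for the
      -- pivot coordinate, which gives - r c. Row i of D vanishes by construction, the other rows by
      -- `h`.
      inj′ c h = entries λ j k → entry (inj (⊖ (r · c) ▿ c) (begin
        A · (⊖ (r · c) ▿ c)          ≈⟨ ·-congʳ (▹-η A) ⟩
        (a ▹ A₁) · (⊖ (r · c) ▿ c)   ≈⟨ ▹·▿ a A₁ (⊖ (r · c)) c ⟩
        a · (⊖ (r · c)) ⊕ A₁ · c     ≈⟨ ⊕-comm _ _ ⟩
        A₁ · c ⊕ a · (⊖ (r · c))     ≈⟨ ⊕-congˡ (⊖-·ʳ a (r · c)) ⟩
        A₁ · c ⊕ ⊖ (a · r · c)       ≈⟨ ⊕-congˡ (⊖-cong (·-assoc a r c)) ⟨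
        A₁ · c ⊕ ⊖ ((a · r) · c)     ≈⟨ ⊕-congˡ (⊖-·ˡ (a · r) c) ⟨
        A₁ · c ⊕ (⊖ (a · r)) · c     ≈⟨ ·-distribʳ c A₁ (⊖ (a · r)) ⟨
        D · c                        ≈⟨ entries Dc≈0 ⟩
        𝟎                            ∎)) (suc j) k
        where
        Dc≈0 : ∀ x k → (D · c) x k ≈ 0#
        Dc≈0 x k with i FinP.≟ x
        ... | yes ≡.refl = trans (reflexive (·-entry D c i k)) (sum-zero λ j → trans (*-congʳ (Dᵢ≈0 j)) (zeroˡ _))
        ... | no i≢x = ≡.subst (λ x → (D · c) x k ≈ 0#) (FinP.punchIn-punchOut i≢x)
          (trans (sym (entry (·-rows (punchIn i) D c) (punchOut i≢x) k)) (entry h (punchOut i≢x) k))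

  left-inverse⇒≤ : {X : Mat n m} {B : Mat m n} → X · B ≋ 𝟏 → n ≤ m
  left-inverse⇒≤ {B = B} e = injective⇒≤ B λ c → injectiveˡ-𝟎 e

  -- Rank factorisations, idempotents and inverses

  covector : {a : Mat m 1} → ¬ (a ≋ 𝟎) → ¬ ¬ (∃[ φ ] φ · a ≋ 𝟏)
  covector {a = a} a≉0 = do
    (i , zero , aᵢ≉0) ← nonzero-entry a≉0
    (b , aᵢb≈1)       ← invert aᵢ≉0
    return ((λ _ j → b * 𝟏 i j) , entries λ { zero zero →
      trans (reflexive (·-entry (λ _ j → b * 𝟏 i j) a zero zero))
      (trans (sum-cong-≋ λ l → *-assoc b (𝟏 i l) (a l zero))
      (trans (sym (*-distribˡ-sum b (λ l → 𝟏 i l * a l zero)))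
      (trans (*-congˡ (𝟏-row i (λ l → a l zero))) (trans (*-comm b _) aᵢb≈1)))) })

  -- Full rank of both factors is witnessed by one-sided inverses, so cancelling them is plain
  -- matrix algebra. The columns of B span the image of A, and the kernel of C is the kernel of A.
  record FullFactorisation {m n} (A : Mat m n) : Set (c ⊔ ℓ) where
    field
      {rank} : ℕ
      B      : Mat m rank
      C      : Mat rank n
      B⁻     : Mat rank m
      C⁻     : Mat n rank
      factor : A ≋ B · C
      B⁻B    : B⁻ · B ≋ 𝟏
      CC⁻    : C · C⁻ ≋ 𝟏

  𝟏-block′ : {a : Mat 1 1} {b : Mat 1 n} {c : Mat n 1} {D : Mat n n} →
             a ≋ 𝟏 → b ≋ 𝟎 → c ≋ 𝟎 → D ≋ 𝟏 → (a ▹ b) ▿ (c ▹ D) ≋ 𝟏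
  𝟏-block′ a b c d = ≋-trans (▿-cong (▹-cong a b) (▹-cong c d)) (≋-sym 𝟏-block)

  -- Subtracting from a its part B B⁻ a leaves a′. If a′ vanishes, a is a combination of the columns
  -- of B and the rank stays; otherwise a′ becomes a new column of B. The choice is not decidable,
  -- hence the double negation.
  extend : (a : Mat m 1) (A : Mat m n) → FullFactorisation A → ¬ ¬ FullFactorisation (a ▹ A)
  extend {m} {n} a A ff = do
    no a′≉0 ← ¬¬-excluded-middle {A = a′ ≋ 𝟎}
      where yes a′≋0 → return (dependent a′≋0)
    (φ₀ , φ₀a′) ← covector a′≉0
    return (independent φ₀ φ₀a′)
    where
    open FullFactorisation ff
    g : Mat rank 1
    g = B⁻ · a
    a′ : Mat m 1
    a′ = a ⊕ ⊖ (B · g)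

    a′⊕Bg : a′ ⊕ B · g ≋ a
    a′⊕Bg = ≋-trans (⊕-assoc _ _ _) (≋-trans (⊕-congˡ (⊕-inverseˡ _)) (⊕-identityʳ a))

    B⁻a′ : B⁻ · a′ ≋ 𝟎
    B⁻a′ = begin
      B⁻ · a′                       ≈⟨ ·-distribˡ B⁻ a (⊖ (B · g)) ⟩
      g ⊕ B⁻ · (⊖ (B · g))          ≈⟨ ⊕-congˡ (⊖-·ʳ B⁻ (B · g)) ⟩
      g ⊕ ⊖ (B⁻ · B · g)            ≈⟨ ⊕-congˡ (⊖-cong (cancelˡ B⁻B g)) ⟩
      g ⊕ ⊖ g                       ≈⟨ ⊕-inverseʳ g ⟩
      𝟎                             ∎

    dependent : a′ ≋ 𝟎 → FullFactorisation (a ▹ A)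
    dependent a′≋0 = record
      { B = B ; C = g ▹ C ; B⁻ = B⁻ ; C⁻ = 𝟎 ▿ C⁻
      ; factor = ≋-sym (≋-trans (·-▹ B g C) (▹-cong
          (≋-trans (≋-sym (⊕-identityˡ _)) (≋-trans (⊕-congʳ (≋-sym a′≋0)) a′⊕Bg)) (≋-sym factor)))
      ; B⁻B = B⁻B
      ; CC⁻ = ≋-trans (▹·▿ g C 𝟎 C⁻) (≋-trans (⊕-cong (·-zeroʳ g) CC⁻) (⊕-identityˡ 𝟏))
      }

    independent : (φ₀ : Mat 1 m) → φ₀ · a′ ≋ 𝟏 → FullFactorisation (a ▹ A)
    independent φ₀ φ₀a′ = record
      { B = a′ ▹ B ; C = (𝟏 ▹ 𝟎) ▿ (g ▹ C) ; B⁻ = φ ▿ B⁻ ; C⁻ = (𝟏 ▹ 𝟎) ▿ (h ▹ C⁻)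
      ; factor = ≋-sym (begin
          (a′ ▹ B) · ((𝟏 ▹ 𝟎) ▿ (g ▹ C))       ≈⟨ ▹·▿ a′ B (𝟏 ▹ 𝟎) (g ▹ C) ⟩
          a′ · (𝟏 ▹ 𝟎) ⊕ B · (g ▹ C)           ≈⟨ ⊕-cong (·-▹ a′ 𝟏 𝟎) (·-▹ B g C) ⟩
          (a′ · 𝟏 ▹ a′ · 𝟎) ⊕ (B · g ▹ B · C)  ≈⟨ ▹-⊕ _ _ _ _ ⟩
          (a′ · 𝟏 ⊕ B · g) ▹ (a′ · 𝟎 ⊕ B · C)  ≈⟨ ▹-cong
              (≋-trans (⊕-congʳ (·-identityʳ a′)) a′⊕Bg)
              (≋-trans (⊕-cong (·-zeroʳ a′) (≋-sym factor)) (⊕-identityˡ A)) ⟩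
          a ▹ A                                ∎)
      ; B⁻B = begin
          (φ ▿ B⁻) · (a′ ▹ B)                              ≈⟨ ▿-· φ B⁻ (a′ ▹ B) ⟩
          φ · (a′ ▹ B) ▿ B⁻ · (a′ ▹ B)                     ≈⟨ ▿-cong (·-▹ φ a′ B) (·-▹ B⁻ a′ B) ⟩
          (φ · a′ ▹ φ · B) ▿ (B⁻ · a′ ▹ B⁻ · B)            ≈⟨ 𝟏-block′ φa′ φB B⁻a′ B⁻B ⟩
          𝟏                                                ∎
      ; CC⁻ = begin
          ((𝟏 ▹ 𝟎) ▿ (g ▹ C)) · C⁻′                        ≈⟨ ▿-· (𝟏 ▹ 𝟎) (g ▹ C) C⁻′ ⟩
          (𝟏 ▹ 𝟎) · C⁻′ ▿ (g ▹ C) · C⁻′                    ≈⟨ ▿-cong top bottom ⟩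
          (𝟏 ▹ 𝟎) ▿ (𝟎 ▹ 𝟏)                                ≈⟨ 𝟏-block ⟨
          𝟏                                                ∎
      }
      where
      -- `φ₀` corrected to vanish on the columns of B; as B⁻ already kills a′, stacking φ on B⁻
      -- gives a left inverse of the enlarged B.
      φ : Mat 1 m
      φ = φ₀ ⊕ ⊖ ((φ₀ · B) · B⁻)
      h : Mat n 1
      h = ⊖ (C⁻ · g)
      C⁻′ : Mat (suc n) (suc rank)
      C⁻′ = (𝟏 ▹ 𝟎) ▿ (h ▹ C⁻)

      ▹-⊕ : ∀ {m n} (a b : Mat m 1) (A B : Mat m n) → (a ▹ A) ⊕ (b ▹ B) ≋ (a ⊕ b) ▹ (A ⊕ B)
      ▹-⊕ a b A B = entries λ { i zero → refl ; i (suc j) → refl }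

      φ-· : ∀ {n} (Y : Mat m n) → φ · Y ≋ φ₀ · Y ⊕ ⊖ ((φ₀ · B) · B⁻ · Y)
      φ-· Y = ≋-trans (·-distribʳ Y φ₀ _) (⊕-congˡ (≋-trans (⊖-·ˡ _ Y) (⊖-cong (·-assoc _ B⁻ Y))))

      φa′ : φ · a′ ≋ 𝟏
      φa′ = begin
        φ · a′                                ≈⟨ φ-· a′ ⟩
        φ₀ · a′ ⊕ ⊖ ((φ₀ · B) · B⁻ · a′)      ≈⟨ ⊕-cong φ₀a′ (⊖-cong (≋-trans (·-congˡ B⁻a′) (·-zeroʳ _))) ⟩
        𝟏 ⊕ ⊖ 𝟎                               ≈⟨ ⊕-congˡ ⊖-𝟎 ⟩
        𝟏 ⊕ 𝟎                                 ≈⟨ ⊕-identityʳ 𝟏 ⟩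
        𝟏                                     ∎

      φB : φ · B ≋ 𝟎
      φB = begin
        φ · B                                 ≈⟨ φ-· B ⟩
        φ₀ · B ⊕ ⊖ ((φ₀ · B) · B⁻ · B)        ≈⟨ ⊕-congˡ (⊖-cong (≋-trans (·-congˡ B⁻B) (·-identityʳ _))) ⟩
        φ₀ · B ⊕ ⊖ (φ₀ · B)                   ≈⟨ ⊕-inverseʳ _ ⟩
        𝟎                                     ∎

      top : (𝟏 ▹ 𝟎) · C⁻′ ≋ 𝟏 ▹ 𝟎
      top = ≋-trans (▹·▿ 𝟏 𝟎 _ _) (≋-trans (⊕-cong (·-identityˡ _) (·-zeroˡ _)) (⊕-identityʳ _))

      bottom : (g ▹ C) · C⁻′ ≋ 𝟎 ▹ 𝟏
      bottom = begin
        (g ▹ C) · C⁻′                            ≈⟨ ▹·▿ g C _ _ ⟩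
        g · (𝟏 ▹ 𝟎) ⊕ C · (h ▹ C⁻)               ≈⟨ ⊕-cong (·-▹ g 𝟏 𝟎) (·-▹ C h C⁻) ⟩
        (g · 𝟏 ▹ g · 𝟎) ⊕ (C · h ▹ C · C⁻)       ≈⟨ ▹-⊕ _ _ _ _ ⟩
        (g · 𝟏 ⊕ C · h) ▹ (g · 𝟎 ⊕ C · C⁻)       ≈⟨ ▹-cong
            (≋-trans (⊕-cong (·-identityʳ g) (≋-trans (⊖-·ʳ C _) (⊖-cong (cancelˡ CC⁻ g)))) (⊕-inverseʳ g))
            (≋-trans (⊕-cong (·-zeroʳ g) CC⁻) (⊕-identityˡ 𝟏)) ⟩
        𝟎 ▹ 𝟏                                    ∎

  ≋-factorisation : {A B : Mat m n} → A ≋ B → FullFactorisation A → FullFactorisation B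
  ≋-factorisation e ff = record
    { B = B ; C = C ; B⁻ = B⁻ ; C⁻ = C⁻ ; factor = ≋-trans (≋-sym e) factor ; B⁻B = B⁻B ; CC⁻ = CC⁻ }
    where open FullFactorisation ff

  full-factorisation : (A : Mat m n) → ¬ ¬ FullFactorisation A
  full-factorisation {n = zero} A = return record
    { B = 𝟎 ; C = 𝟏 ; B⁻ = 𝟎 ; C⁻ = 𝟏 ; factor = entries λ _ () ; B⁻B = entries λ () ; CC⁻ = entries λ () }
  full-factorisation {n = suc n} A = do
    ff  ← full-factorisation (λ i j → A i (suc j))
    ff′ ← extend (λ i _ → A i zero) _ ff
    return (≋-factorisation (≋-sym (▹-η A)) ff′)

  -- For an idempotent E this splits the opposite projection: B C = 𝟏 - E, and the columns of B span
  -- the kernel of E. The rank of E enters only through `corank-≤`, as a number of independent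
  -- columns fixed by E.
  record Complement {n} (E : Mat n n) : Set (c ⊔ ℓ) where
    field
      {corank} : ℕ
      B        : Mat n corank
      C        : Mat corank n
      CB       : C · B ≋ 𝟏
      EB       : E · B ≋ 𝟎
      CE       : C · E ≋ 𝟎
      E⊕BC     : E ⊕ B · C ≋ 𝟏
      corank-≤ : ∀ {m} (Y : Mat n m) → E · Y ≋ Y →
                 (∀ (c : Mat m 1) → Y · c ≋ 𝟎 → c ≋ 𝟎) → m ℕ.+ corank ≤ n

  complement : {E : Mat n n} → E · E ≋ E → ¬ ¬ Complement E
  complement {n} {E} EE = do
    ff ← full-factorisation G
    return (build ff)
    where
    G : Mat n n
    G = 𝟏 ⊕ ⊖ E

    EG : E · G ≋ 𝟎
    EG = begin
      E · G               ≈⟨ ·-distribˡ E 𝟏 (⊖ E) ⟩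
      E · 𝟏 ⊕ E · (⊖ E)   ≈⟨ ⊕-cong (·-identityʳ E) (≋-trans (⊖-·ʳ E E) (⊖-cong EE)) ⟩
      E ⊕ ⊖ E             ≈⟨ ⊕-inverseʳ E ⟩
      𝟎                   ∎

    GE : G · E ≋ 𝟎
    GE = begin
      G · E               ≈⟨ ·-distribʳ E 𝟏 (⊖ E) ⟩
      𝟏 · E ⊕ (⊖ E) · E   ≈⟨ ⊕-cong (·-identityˡ E) (≋-trans (⊖-·ˡ E E) (⊖-cong EE)) ⟩
      E ⊕ ⊖ E             ≈⟨ ⊕-inverseʳ E ⟩
      𝟎                   ∎

    build : FullFactorisation G → Complement E
    build ff = record
      { B = B ; C = C ; EB = EB ; CE = CE
      -- G is idempotent, so B (C B) C = B 𝟏 C, and the outer factors cancel.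
      ; CB = injectiveˡ B⁻B (injectiveʳ CC⁻ (begin
          (B · C · B) · C     ≈⟨ ·-assoc B (C · B) C ⟩
          B · (C · B) · C     ≈⟨ ·-congˡ (·-assoc C B C) ⟩
          B · C · B · C       ≈⟨ ·-assoc B C _ ⟨
          (B · C) · B · C     ≈⟨ ·-cong factor factor ⟨
          G · G               ≈⟨ ·-distribʳ G 𝟏 (⊖ E) ⟩
          𝟏 · G ⊕ (⊖ E) · G   ≈⟨ ⊕-cong (·-identityˡ G) (≋-trans (⊖-·ˡ E G) (≋-trans (⊖-cong EG) ⊖-𝟎)) ⟩
          G ⊕ 𝟎               ≈⟨ ⊕-identityʳ G ⟩
          G                   ≈⟨ factor ⟩
          B · C               ≈⟨ ·-congʳ (·-identityʳ B) ⟨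
          (B · 𝟏) · C         ∎))
      ; E⊕BC = begin
          E ⊕ B · C      ≈⟨ ⊕-congˡ factor ⟨
          E ⊕ (𝟏 ⊕ ⊖ E)  ≈⟨ ⊕-comm _ _ ⟩
          (𝟏 ⊕ ⊖ E) ⊕ E  ≈⟨ ⊕-assoc _ _ _ ⟩
          𝟏 ⊕ (⊖ E ⊕ E)  ≈⟨ ⊕-congˡ (⊕-inverseˡ E) ⟩
          𝟏 ⊕ 𝟎          ≈⟨ ⊕-identityʳ 𝟏 ⟩
          𝟏              ∎
      ; corank-≤ = bound
      }
      where
      open FullFactorisation ff
      EB : E · B ≋ 𝟎
      EB = injectiveʳ-𝟎 CC⁻ (≋-trans (·-assoc E B C) (≋-trans (·-congˡ (≋-sym factor)) EG))
      CE : C · E ≋ 𝟎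
      CE = injectiveˡ-𝟎 B⁻B (≋-trans (≋-sym (·-assoc B C E)) (≋-trans (·-congʳ (≋-sym factor)) GE))

      bound : ∀ {m} (Y : Mat n m) → E · Y ≋ Y →
              (∀ (c : Mat m 1) → Y · c ≋ 𝟎 → c ≋ 𝟎) → m ℕ.+ rank ≤ n
      bound Y EY inj = injective⇒≤ (Y ∣ B) (∣-injective Y B separate)
        where
        separate : ∀ c₁ c₂ → Y · c₁ ⊕ B · c₂ ≋ 𝟎 → c₁ ≋ 𝟎 × c₂ ≋ 𝟎
        separate c₁ c₂ h = inj c₁ Yc₁ ,
          injectiveˡ-𝟎 B⁻B (≋-trans (≋-sym (⊕-identityˡ _)) (≋-trans (⊕-congʳ (≋-sym Yc₁)) h))
          where
          Yc₁ : Y · c₁ ≋ 𝟎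
          Yc₁ = begin
            Y · c₁                         ≈⟨ ⊕-identityʳ _ ⟨
            Y · c₁ ⊕ 𝟎                     ≈⟨ ⊕-cong (≋-trans (≋-sym (·-assoc E Y c₁)) (·-congʳ EY))
                                                (≋-trans (≋-sym (·-assoc E B c₂)) (≋-trans (·-congʳ EB) (·-zeroˡ c₂))) ⟨
            E · Y · c₁ ⊕ E · B · c₂        ≈⟨ ·-distribˡ E _ _ ⟨
            E · (Y · c₁ ⊕ B · c₂)          ≈⟨ ·-congˡ h ⟩
            E · 𝟎                          ≈⟨ ·-zeroʳ E ⟩
            𝟎                              ∎

  ·-empty : ∀ {r} (Y : Mat m r) (Z : Mat r n) → r ≤ 0 → Y · Z ≋ 𝟎
  ·-empty Y Z z≤n = entries λ i j → reflexive (·-entry Y Z i j)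

  -- B X is idempotent and fixes the n independent columns of B, so its complement has corank 0.
  one-sided-inverse : {X B : Mat n n} → X · B ≋ 𝟏 → B · X ≋ 𝟏
  one-sided-inverse {n} {X} {B} XB = ≋-stable do
    cpl ← complement {E = B · X} (≋-trans (·-assoc B X _) (·-congˡ (cancelˡ XB X)))
    return (full cpl)
    where
    full : Complement (B · X) → B · X ≋ 𝟏
    full cpl = ≋-trans (≋-sym (⊕-identityʳ _)) (≋-trans (⊕-congˡ (≋-sym (·-empty B₂ C₂ corank≤0))) E⊕BC)
      where
      open Complement cpl renaming (B to B₂; C to C₂)
      corank≤0 : corank ≤ 0
      corank≤0 = ℕP.+-cancelˡ-≤ n corank 0 (≡.subst (n ℕ.+ corank ≤_) (≡.sym (ℕP.+-identityʳ n))
        (corank-≤ B (≋-trans (·-assoc B X B) (≋-trans (·-congˡ XB) (·-identityʳ B))) λ c → injectiveˡ-𝟎 XB))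

  Invertible : Mat n n → Set (c ⊔ ℓ)
  Invertible A = ∃[ X ] X · A ≋ 𝟏 × A · X ≋ 𝟏

  invertible-if-rank≥ : {A : Mat n n} (ff : FullFactorisation A) → n ≤ FullFactorisation.rank ff → Invertible A
  invertible-if-rank≥ {n} {A} ff n≤r = go (ℕP.≤-antisym n≤r (left-inverse⇒≤ B⁻B)) B C B⁻ C⁻ factor B⁻B CC⁻
    where
    open FullFactorisation ff
    -- The rank is generalised to a variable here, so that the equation n ≡ r can be matched and the
    -- factors become square.
    go : ∀ {r} → n ≡ r → (B : Mat n r) (C : Mat r n) (B⁻ : Mat r n) (C⁻ : Mat n r) →
         A ≋ B · C → B⁻ · B ≋ 𝟏 → C · C⁻ ≋ 𝟏 → Invertible A
    go ≡.refl B C B⁻ C⁻ factor B⁻B CC⁻ = X , XA , one-sided-inverse XA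
      where
      X : Mat n n
      X = C⁻ · B⁻
      XA : X · A ≋ 𝟏
      XA = begin
        (C⁻ · B⁻) · A       ≈⟨ ·-congˡ factor ⟩
        (C⁻ · B⁻) · B · C   ≈⟨ ·-assoc C⁻ B⁻ _ ⟩
        C⁻ · B⁻ · B · C     ≈⟨ ·-congˡ (cancelˡ B⁻B C) ⟩
        C⁻ · C              ≈⟨ one-sided-inverse CC⁻ ⟩
        𝟏                   ∎

  -- Generic vectors and the Gram matrix bound

  open import Algebra.Properties.AbelianGroup +-abelianGroup using () renaming (∙-cancelˡ to +-cancelˡ; ⁻¹-anti-homo‿- to neg-sub; x∙y⁻¹≈ε⇒x≈y to x-y≈0⇒x≈y)

  x*z≈y*z⇒z≈0 : ∀ {x y z} → ¬ (x ≈ y) → x * z ≈ y * z → z ≈ 0#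
  x*z≈y*z⇒z≈0 {x} {y} {z} x≉y e = x*y≈0⇒y≈0 (λ d → x≉y (x-y≈0⇒x≈y x y d))
    (trans (distribʳ z x (- y)) (trans (+-cong e (sym (-‿distribˡ-* y z))) (-‿inverseʳ (y * z))))

  -- For each i at most one of the covectors φ + t z kills a i, so among k + 2
  -- values of t some φ + t z works.
  nonvanishing-covector : (a : Fin k → Mat n 1) → (∀ i → ¬ (a i ≋ 𝟎)) →
    ¬ ¬ (∃[ φ ] (∀ i → ¬ (φ · a i ≋ 𝟎 {1})))
  nonvanishing-covector {zero}  a a≉0 = return (𝟎 , λ ())
  nonvanishing-covector {suc k} a a≉0 = do
    (φ , φa≉0) ← nonvanishing-covector (a ∘ suc) (a≉0 ∘ suc)
    (z , za≋𝟏) ← covector (a≉0 zero)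
    λ none → ¬¬-∀Fin (λ t fails → none (combination φ z t , λ i e → fails (i , e)))
      (clash φ φa≉0 z za≋𝟏)
    where
    scalar : Fin (suc (suc k)) → Mat 1 1
    scalar t _ _ = ν (toℕ t)

    combination : (φ z : Mat 1 _) → Fin (suc (suc k)) → Mat 1 _
    combination φ z t = φ ⊕ scalar t · z

    expand : ∀ φ z t i → (combination φ z t · a i) zero zero ≈
             (φ · a i) zero zero + ν (toℕ t) * (z · a i) zero zero
    expand φ z t i = trans (entry (·-distribʳ (a i) φ _) zero zero) (+-congˡ
      (trans (entry (·-assoc (scalar t) z (a i)) zero zero)
      (trans (reflexive (·-entry (scalar t) (z · a i) zero zero)) (+-identityʳ _))))

    clash : ∀ φ → (∀ i → ¬ (φ · a (suc i) ≋ 𝟎)) → ∀ z → z · a zero ≋ 𝟏 →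
            ¬ (∀ t → ∃[ i ] combination φ z t · a i ≋ 𝟎)
    clash φ φa≉0 z za≋𝟏 bad = finish
      where
      index : Fin (suc (suc k)) → Fin (suc k)
      index t = proj₁ (bad t)
      finish : ⊥
      finish with s , t , s<t , same ← FinP.pigeonhole (ℕP.n<1+n (suc k)) index = go (index t) eₛ eₜ
        where
        i = index t
        root : ∀ t i → combination φ z t · a i ≋ 𝟎 → (φ · a i) zero zero + ν (toℕ t) * (z · a i) zero zero ≈ 0#
        root t i e = trans (sym (expand φ z t i)) (entry e zero zero)
        eₛ = root s i (≡.subst (λ i → combination φ z s · a i ≋ 𝟎) same (proj₂ (bad s)))
        eₜ = root t i (proj₂ (bad t))
        go : ∀ i → (φ · a i) zero zero + ν (toℕ s) * (z · a i) zero zero ≈ 0# →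
             (φ · a i) zero zero + ν (toℕ t) * (z · a i) zero zero ≈ 0# → ⊥
        go i eₛ eₜ = vanishes i za≈0 φa≈0
          where
          za≈0 : (z · a i) zero zero ≈ 0#
          za≈0 = x*z≈y*z⇒z≈0 (λ e → ℕP.<⇒≢ s<t (ν-injective e)) (+-cancelˡ _ _ _ (trans eₛ (sym eₜ)))
          φa≈0 : (φ · a i) zero zero ≈ 0#
          φa≈0 = trans (sym (trans (+-congˡ (trans (*-congˡ za≈0) (zeroʳ _))) (+-identityʳ _))) eₛ
          -- Failure at two values of t makes both z and φ kill a i; but z takes the value 𝟏 on the
          -- first vector, and φ kills none of the others.
          vanishes : ∀ i → (z · a i) zero zero ≈ 0# → (φ · a i) zero zero ≈ 0# → ⊥
          vanishes zero    za≈0 _    = 1≉0 (trans (sym (entry za≋𝟏 zero zero)) za≈0)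
          vanishes (suc i) _    φa≈0 = φa≉0 i (entries λ { zero zero → φa≈0 })

  -- Genericity is used twice: a φ that keeps one chosen nonzero column of each Q i alive makes all
  -- rows φ Q i nonzero, and after transposition a second covector supplies v.
  nonvanishing-form : (Q : Fin k → Mat m n) → (∀ i → ¬ (Q i ≋ 𝟎)) →
    ¬ ¬ (∃[ φ ] ∃[ v ] (∀ i → ¬ (φ · Q i · v ≋ 𝟎 {1} {1})))
  nonvanishing-form Q Q≉0 = do
    cols       ← ¬¬-∀Fin λ i → nonzero-column (Q≉0 i)
    (φ , φ≉0)  ← nonvanishing-covector (λ i x _ → Q i x (proj₁ (cols i))) (proj₂ ∘ cols)
    (ψ , ψ≉0)  ← nonvanishing-covector (λ i → (φ · Q i) ᵀ) (λ i e → φ≉0 i (column i (proj₁ (cols i)) φ e))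
    return (φ , ψ ᵀ , λ i e → ψ≉0 i (begin
      ψ · (φ · Q i) ᵀ          ≈⟨ ·-ᵀ (φ · Q i) (ψ ᵀ) ⟨
      ((φ · Q i) · ψ ᵀ) ᵀ      ≈⟨ ᵀ-cong (≋-trans (·-assoc φ (Q i) (ψ ᵀ)) e) ⟩
      𝟎                        ∎))
    where
    nonzero-column : ∀ {A : Mat m n} → ¬ (A ≋ 𝟎) → ¬ ¬ (∃[ j ] ¬ ((λ x (_ : Fin 1) → A x j) ≋ 𝟎))
    nonzero-column A≉0 = do
      (i , j , Aᵢⱼ≉0) ← nonzero-entry A≉0
      return (j , λ e → Aᵢⱼ≉0 (entry e i zero))
    column : ∀ i j φ → (φ · Q i) ᵀ ≋ 𝟎 → φ · (λ x (_ : Fin 1) → Q i x j) ≋ 𝟎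
    column i j φ e = entries λ { zero zero →
      trans (reflexive (≡.trans (·-entry φ (λ x _ → Q i x j) zero zero) (≡.sym (·-entry φ (Q i) zero j)))) (entry e j zero) }

  Anticommuting : (Fin k → Mat n n) → Set ℓ
  Anticommuting e = ∀ i j → i ≢ j → e i · e j ≋ ⊖ (e j · e i)

  -- The Gram matrix M i j = φ (e i) (e j) v has rank at most r, while M + Mᵀ is
  -- diagonal with non-zero diagonal.
  bilinear-bound : ∀ {r} (e : Fin k → Mat n n) → Anticommuting e → (∀ i → ¬ (e i · e i ≋ 𝟎)) →
    (X : Fin k → Mat n r) (Y : Fin k → Mat r n) → (∀ i j → e i · e j ≋ X i · Y j) → k ≤ r ℕ.+ r
  bilinear-bound {k} {n} {r} e anti sq≉0 X Y fac = decidable-stable (k ℕP.≤? r ℕ.+ r) do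
    (φ , v , φv≉0) ← nonvanishing-form (λ i → e i · e i) sq≉0
    return (Gram.bound φ v φv≉0)
    where
    module Gram (φ : Mat 1 n) (v : Mat n 1) (φv≉0 : ∀ i → ¬ (φ · (e i · e i) · v ≋ 𝟎 {1} {1})) where
      U : Mat k r
      U i = (φ · X i) zero
      V : Mat r k
      V l i = (Y i · v) l zero

      UV : ∀ i j → (U · V) i j ≈ (φ · (e i · e j) · v) zero zero
      UV i j = trans (reflexive (≡.trans (·-entry U V i j) (≡.sym (·-entry (φ · X i) (Y j · v) zero zero))))
        (entry (begin
          (φ · X i) · Y j · v      ≈⟨ ·-assoc φ (X i) _ ⟩
          φ · X i · Y j · v        ≈⟨ ·-congˡ (·-assoc (X i) (Y j) v) ⟨
          φ · (X i · Y j) · v      ≈⟨ ·-congˡ (·-congʳ (fac i j)) ⟨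
          φ · (e i · e j) · v      ∎) zero zero)

      UV-anti : ∀ i j → i ≢ j → (U · V) i j + (U · V) j i ≈ 0#
      UV-anti i j i≢j = trans (+-cong (UV i j) (UV j i)) (entry (begin
        φ · (e i · e j) · v ⊕ φ · (e j · e i) · v  ≈⟨ ·-distribˡ φ _ _ ⟨
        φ · ((e i · e j) · v ⊕ (e j · e i) · v)    ≈⟨ ·-congˡ (·-distribʳ v _ _) ⟨
        φ · (e i · e j ⊕ e j · e i) · v            ≈⟨ ·-congˡ (·-congʳ (≋-trans (⊕-congʳ (anti i j i≢j)) (⊕-inverseˡ _))) ⟩
        φ · 𝟎 · v                                  ≈⟨ ≋-trans (·-congˡ (·-zeroˡ v)) (·-zeroʳ φ) ⟩
        𝟎                                          ∎) zero zero)

      UV-diagonal : ∀ i → ¬ ((U · V) i i + (U · V) i i ≈ 0#)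
      UV-diagonal i h = φv≉0 i (entries λ { zero zero → trans (sym (UV i i)) (x+x≈0⇒x≈0 h) })

      -- The stacked matrix has r + r rows, the source of the factor 2: a vector killed by both Uᵀ
      -- and V is killed by U V and by its transpose, hence by their sum, which is diagonal with
      -- nonzero diagonal.
      injective : ∀ (c : Mat k 1) → (U ᵀ ++ V) · c ≋ 𝟎 → c ≋ 𝟎
      injective c h = entries λ { j zero → x*y≈0⇒y≈0 (UV-diagonal j) (trans (sym (row j)) (entry Mc≋0 j zero)) }
        where
        Uᵀc : U ᵀ · c ≋ 𝟎
        Uᵀc = ≋-trans (·-congʳ (entries λ i j → reflexive (≡.cong (λ f → f j) (≡.sym (lookup-++ˡ (U ᵀ) V i)))))
          (≋-trans (·-rows (_↑ˡ r) (U ᵀ ++ V) c) (entries λ i j → entry h (i ↑ˡ r) j))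
        Vc : V · c ≋ 𝟎
        Vc = ≋-trans (·-congʳ (entries λ i j → reflexive (≡.cong (λ f → f j) (≡.sym (lookup-++ʳ (U ᵀ) V i)))))
          (≋-trans (·-rows (r ↑ʳ_) (U ᵀ ++ V) c) (entries λ i j → entry h (r ↑ʳ i) j))
        M : Mat k k
        M = U · V ⊕ (U · V) ᵀ
        Mc≋0 : M · c ≋ 𝟎
        Mc≋0 = begin
          M · c                              ≈⟨ ·-distribʳ c _ _ ⟩
          (U · V) · c ⊕ (U · V) ᵀ · c        ≈⟨ ⊕-cong (·-assoc U V c) (≋-trans (·-congʳ (·-ᵀ U V)) (·-assoc (V ᵀ) (U ᵀ) c)) ⟩
          U · V · c ⊕ V ᵀ · U ᵀ · c          ≈⟨ ⊕-cong (≋-trans (·-congˡ Vc) (·-zeroʳ U)) (≋-trans (·-congˡ Uᵀc) (·-zeroʳ (V ᵀ))) ⟩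
          𝟎 ⊕ 𝟎                              ≈⟨ ⊕-identityʳ 𝟎 ⟩
          𝟎                                  ∎
        row : ∀ j → (M · c) j zero ≈ ((U · V) j j + (U · V) j j) * c j zero
        row j = trans (reflexive (·-entry M c j zero)) (sum-single j λ i i≢j →
          trans (*-congʳ (UV-anti j i (i≢j ∘ ≡.sym))) (zeroˡ _))

      bound : k ≤ r ℕ.+ r
      bound = injective⇒≤ (U ᵀ ++ V) injective

  -- Independence of the products in the invertible case

  lc : Mat k 1 → (Fin k → Mat m n) → Mat m n
  lc c X x y = sum (λ s → X s x y * c s zero)

  lc-⊕ : (c : Mat k 1) (X Y : Fin k → Mat m n) → lc c X ⊕ lc c Y ≋ lc c (λ s → X s ⊕ Y s)
  lc-⊕ c X Y = entries λ x y → sym (trans (sum-cong-≋ λ s → distribʳ (c s zero) (X s x y) (Y s x y))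
    (∑-distrib-+ (λ s → X s x y * c s zero) (λ s → Y s x y * c s zero)))

  lc-⊖ : (c : Mat k 1) (X : Fin k → Mat m n) → ⊖ lc c X ≋ lc c (λ s → ⊖ X s)
  lc-⊖ c X = entries λ x y → trans (sum-neg (λ s → X s x y * c s zero)) (sum-cong-≋ λ s → -‿distribˡ-* (X s x y) (c s zero))

  lc-·ˡ : (c : Mat k 1) (A : Mat m n) (X : Fin k → Mat n p) → A · lc c X ≋ lc c (λ s → A · X s)
  lc-·ˡ c A X = entries λ x y → trans (reflexive (·-entry A (lc c X) x y))
    (trans (sum-cong-≋ λ l → trans (*-distribˡ-sum (A x l) (λ s → X s l y * c s zero)) (sum-cong-≋ λ s → sym (*-assoc (A x l) (X s l y) (c s zero))))
    (trans (∑-comm λ l s → A x l * X s l y * c s zero)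
    (sum-cong-≋ λ s → trans (sym (*-distribʳ-sum (c s zero) (λ l → A x l * X s l y))) (*-congʳ (reflexive (≡.sym (·-entry A (X s) x y)))))))

  lc-·ʳ : (c : Mat k 1) (X : Fin k → Mat m n) (A : Mat n p) → lc c X · A ≋ lc c (λ s → X s · A)
  lc-·ʳ c X A = entries λ x y → trans (entry (·-ᵀ (lc c X) A) y x)
    (trans (entry (lc-·ˡ c (A ᵀ) (λ s → X s ᵀ)) y x) (sum-cong-≋ λ s → *-congʳ (sym (entry (·-ᵀ (X s) A) y x))))

  lc-single : (c : Mat k 1) (X : Fin k → Mat m n) (t : Fin k) → (∀ s → s ≢ t → X s ≋ 𝟎) →
    ¬ (X t ≋ 𝟎) → lc c X ≋ 𝟎 → c t zero ≈ 0#
  lc-single c X t X≋𝟎 Xt≉𝟎 h = stable do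
    (x , y , Xtxy≉0) ← nonzero-entry Xt≉𝟎
    return (x*y≈0⇒y≈0 Xtxy≉0 (trans (sym (sum-single t λ s s≢t →
      trans (*-congʳ (entry (X≋𝟎 s s≢t) x y)) (zeroˡ _))) (entry h x y)))

  module _ {k n : ℕ} (X : Fin k → Mat n n) where
    independent⇒≤ : (∀ c → lc c X ≋ 𝟎 → c ≋ 𝟎) → k ≤ n ℕ.* n
    independent⇒≤ inj = injective⇒≤ A λ c h → inj c (entries λ x y →
      trans (reflexive (≡.trans (entry-combine x y c) (≡.sym (·-entry A c (combine x y) zero)))) (entry h (combine x y) zero))
      where
      A : Mat (n ℕ.* n) k
      A z s = X s (proj₁ (remQuot {n} n z)) (proj₂ (remQuot {n} n z))
      entry-combine : ∀ x y c → lc c X x y ≡ sum (λ s → A (combine x y) s * c s zero)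
      entry-combine x y c = ≡.cong (λ p → sum (λ s → X s (proj₁ p) (proj₂ p) * c s zero)) (≡.sym (FinP.remQuot-combine x y))

  -- Conjugation by e l maps e i · e j to itself, up to the sign -1 iff l ∈ {i , j};
  -- hence two commutators isolate one of these products in a linear relation.
  module _ (e : Fin k → Mat n n) (anti : Anticommuting e) (inv : ∀ i → Invertible (e i)) where
    private
      e⁻ : Fin k → Mat n n
      e⁻ i = proj₁ (inv i)

      e⁻e : ∀ i → e⁻ i · e i ≋ 𝟏
      e⁻e i = proj₁ (proj₂ (inv i))

      conj : Fin k → Mat n n → Mat n n
      conj l Y = e⁻ l · Y · e l

      -- Kills the matrices that commute with `e l` and doubles those that anticommute with it.
      twist : Fin k → Mat n n → Mat n n
      twist l Y = Y ⊕ ⊖ conj l Y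

      conj-cong : ∀ l {Y Z} → Y ≋ Z → conj l Y ≋ conj l Z
      conj-cong l h = ·-congˡ (·-congʳ h)

      twist-cong : ∀ l {Y Z} → Y ≋ Z → twist l Y ≋ twist l Z
      twist-cong l h = ⊕-cong h (⊖-cong (conj-cong l h))

      conj-⊕ : ∀ l Y Z → conj l (Y ⊕ Z) ≋ conj l Y ⊕ conj l Z
      conj-⊕ l Y Z = ≋-trans (·-congˡ (·-distribʳ (e l) Y Z)) (·-distribˡ (e⁻ l) _ _)

      twist-lc : ∀ {m} l c (X : Fin m → Mat n n) → twist l (lc c X) ≋ lc c (λ s → twist l (X s))
      twist-lc l c X = ≋-trans (⊕-congˡ (≋-trans (⊖-cong conj-lc) (lc-⊖ c _))) (lc-⊕ c _ _)
        where
        conj-lc : conj l (lc c X) ≋ lc c (λ s → conj l (X s))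
        conj-lc = ≋-trans (·-congˡ (lc-·ʳ c X (e l))) (lc-·ˡ c (e⁻ l) (λ s → X s · e l))

      twist-fixed : ∀ l {Y} → e l · Y ≋ Y · e l → twist l Y ≋ 𝟎
      twist-fixed l {Y} h = ≋-trans (⊕-congˡ (⊖-cong (≋-trans (·-congˡ (≋-sym h)) (cancelˡ (e⁻e l) Y)))) (⊕-inverseʳ Y)

      twist-flipped : ∀ l {Y} → e l · Y ≋ ⊖ (Y · e l) → twist l Y ≋ Y ⊕ Y
      twist-flipped l {Y} h = ⊕-congˡ (begin
        ⊖ (e⁻ l · Y · e l)       ≈⟨ ⊖-cong (·-congˡ (⊖-involutive _)) ⟨
        ⊖ (e⁻ l · ⊖ ⊖ (Y · e l)) ≈⟨ ⊖-cong (·-congˡ (⊖-cong h)) ⟨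
        ⊖ (e⁻ l · ⊖ (e l · Y))   ≈⟨ ⊖-cong (⊖-·ʳ _ _) ⟩
        ⊖ ⊖ (e⁻ l · e l · Y)     ≈⟨ ⊖-involutive _ ⟩
        e⁻ l · e l · Y           ≈⟨ cancelˡ (e⁻e l) Y ⟩
        Y                        ∎)

      twist-𝟎 : ∀ l → twist l 𝟎 ≋ 𝟎
      twist-𝟎 l = twist-fixed l (≋-trans (·-zeroʳ _) (≋-sym (·-zeroˡ _)))

      twist-double : ∀ l {Y} → twist l Y ≋ 𝟎 → twist l (Y ⊕ Y) ≋ 𝟎
      twist-double l {Y} h = begin
        Y ⊕ Y ⊕ ⊖ conj l (Y ⊕ Y)              ≈⟨ ⊕-congˡ (⊖-cong (conj-⊕ l Y Y)) ⟩
        Y ⊕ Y ⊕ ⊖ (conj l Y ⊕ conj l Y)       ≈⟨ ⊕-congˡ (⊖-cong (⊕-cong fixed fixed)) ⟩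
        Y ⊕ Y ⊕ ⊖ (Y ⊕ Y)                     ≈⟨ ⊕-inverseʳ _ ⟩
        𝟎                                     ∎
        where
        fixed : conj l Y ≋ Y
        fixed = entries λ i j → sym (x-y≈0⇒x≈y _ _ (entry h i j))

      X : Fin (tri k) → Mat n n
      X s = e (proj₁ (pair k s)) · e (proj₂ (pair k s))

      pass : ∀ l i j → l ≢ i → l ≢ j → e l · e i · e j ≋ (e i · e j) · e l
      pass l i j l≢i l≢j = begin
        e l · e i · e j        ≈⟨ ·-assoc _ _ _ ⟨
        (e l · e i) · e j      ≈⟨ ·-congʳ (anti l i l≢i) ⟩
        (⊖ (e i · e l)) · e j  ≈⟨ ⊖-·ˡ _ _ ⟩
        ⊖ ((e i · e l) · e j)  ≈⟨ ⊖-cong (·-assoc _ _ _) ⟩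
        ⊖ (e i · e l · e j)    ≈⟨ ⊖-cong (·-congˡ (anti l j l≢j)) ⟩
        ⊖ (e i · ⊖ (e j · e l)) ≈⟨ ⊖-cong (⊖-·ʳ _ _) ⟩
        ⊖ ⊖ (e i · e j · e l)  ≈⟨ ⊖-involutive _ ⟩
        e i · e j · e l        ≈⟨ ·-assoc _ _ _ ⟨
        (e i · e j) · e l      ∎

      flip₁ : ∀ i j → i ≢ j → e i · e i · e j ≋ ⊖ ((e i · e j) · e i)
      flip₁ i j i≢j = begin
        e i · e i · e j          ≈⟨ ·-congˡ (anti i j i≢j) ⟩
        e i · ⊖ (e j · e i)      ≈⟨ ⊖-·ʳ _ _ ⟩
        ⊖ (e i · e j · e i)      ≈⟨ ⊖-cong (·-assoc _ _ _) ⟨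
        ⊖ ((e i · e j) · e i)    ∎

      flip₂ : ∀ i j → i ≢ j → e j · e i · e j ≋ ⊖ ((e i · e j) · e j)
      flip₂ i j i≢j = begin
        e j · e i · e j          ≈⟨ ·-assoc _ _ _ ⟨
        (e j · e i) · e j        ≈⟨ ·-congʳ (anti j i (i≢j ∘ ≡.sym)) ⟩
        (⊖ (e i · e j)) · e j    ≈⟨ ⊖-·ˡ _ _ ⟩
        ⊖ ((e i · e j) · e j)    ∎

      twist-X : ∀ l i j → i ≢ j → twist l (e i · e j) ≋ 𝟎 ⊎ twist l (e i · e j) ≋ e i · e j ⊕ e i · e j
      twist-X l i j i≢j with l FinP.≟ i | l FinP.≟ j
      ... | yes ≡.refl | _          = inj₂ (twist-flipped l (flip₁ i j i≢j))
      ... | no _       | yes ≡.refl = inj₂ (twist-flipped l (flip₂ i j i≢j))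
      ... | no l≢i     | no l≢j     = inj₁ (twist-fixed l (pass l i j l≢i l≢j))

      distinct : ∀ s → proj₁ (pair k s) ≢ proj₂ (pair k s)
      distinct s eq = FinP.<⇒≢ (pair-< k s) eq

      -- Some member of the pair t lies outside the pair s, and its twist kills `X s`; if that is
      -- the second member, the first twist has only doubled or killed `X s`. When both members lie
      -- in the pair s, either s = t or the order i < j is violated.
      isolate : ∀ s t → s ≢ t → twist (proj₂ (pair k t)) (twist (proj₁ (pair k t)) (X s)) ≋ 𝟎
      isolate s t s≢t with proj₁ (pair k t) FinP.≟ proj₁ (pair k s) | proj₁ (pair k t) FinP.≟ proj₂ (pair k s)
        | proj₂ (pair k t) FinP.≟ proj₁ (pair k s) | proj₂ (pair k t) FinP.≟ proj₂ (pair k s)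
      ... | no i≢a | no i≢b | _ | _ = ≋-trans (twist-cong _ (twist-fixed _ (pass _ _ _ i≢a i≢b))) (twist-𝟎 _)
      ... | _ | _ | no j≢a | no j≢b with twist-X (proj₁ (pair k t)) _ _ (distinct s)
      ...   | inj₁ h = ≋-trans (twist-cong _ h) (twist-𝟎 _)
      ...   | inj₂ h = ≋-trans (twist-cong _ h) (twist-double _ (twist-fixed _ (pass _ _ _ j≢a j≢b)))
      isolate s t s≢t | yes i≡a | _ | _ | yes j≡b = contradiction (pair-injective k (≡.cong₂ _,_ (≡.sym i≡a) (≡.sym j≡b))) s≢t
      isolate s t s≢t | yes i≡a | _ | yes j≡a | _ = contradiction (≡.trans i≡a (≡.sym j≡a)) (distinct t)
      isolate s t s≢t | _ | yes i≡b | _ | yes j≡b = contradiction (≡.trans i≡b (≡.sym j≡b)) (distinct t)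
      isolate s t s≢t | _ | yes i≡b | yes j≡a | _ = contradiction
        (≡.subst₂ Fin._<_ i≡b j≡a (pair-< k t)) (FinP.<-asym (pair-< k s))

      -- Each of the two twists doubles `X t`, so the hypothesis says 4 `X t` = 0, and 2 is
      -- cancelled twice.
      survive : ∀ t → twist (proj₂ (pair k t)) (twist (proj₁ (pair k t)) (X t)) ≋ 𝟎 → X t ≋ 𝟎
      survive t h = A⊕A≋𝟎⇒A≋𝟎 (A⊕A≋𝟎⇒A≋𝟎 (≋-trans (≋-sym (≋-trans
        (twist-cong _ (twist-flipped _ (flip₁ _ _ (distinct t))))
        (≋-trans (⊕-congˡ (⊖-cong (conj-⊕ _ _ _))) (≋-trans (⊕-congˡ (≋-sym (⊖-⊕-comm _ _)))
        (≋-trans (interchange (X t) (X t) _ _) (⊕-cong fl fl)))))) h))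
        where
        fl = twist-flipped (proj₂ (pair k t)) (flip₂ _ _ (distinct t))
        open import Algebra.Properties.CommutativeSemigroup (AbelianGroup.commutativeSemigroup (⊕-abelianGroup n n)) using (interchange)

    invertible-bound : (∀ i → ¬ (e i ≋ 𝟎)) → tri k ≤ n ℕ.* n
    invertible-bound e≉𝟎 = independent⇒≤ X λ c h → entries λ { t zero →
      let i = proj₁ (pair k t) ; j = proj₂ (pair k t) in
      lc-single c (λ s → twist j (twist i (X s))) t (λ s s≢t → isolate s t s≢t)
        (λ z → e≉𝟎 j (injectiveˡ-𝟎 (e⁻e i) (survive t z)))
        (begin
          lc c (λ s → twist j (twist i (X s)))   ≈⟨ twist-lc j c _ ⟨
          twist j (lc c (λ s → twist i (X s)))   ≈⟨ twist-cong j (twist-lc i c X) ⟨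
          twist j (twist i (lc c X))             ≈⟨ twist-cong j (twist-cong i h) ⟩
          twist j (twist i 𝟎)                    ≈⟨ ≋-trans (twist-cong j (twist-𝟎 i)) (twist-𝟎 j) ⟩
          𝟎                                      ∎) }

  -- Induction along a matrix of minimal rank

  module Upper {n k : ℕ} (e : Fin k → Mat n n) (anti : Anticommuting e) (sq≉𝟎 : ∀ i → ¬ (e i · e i ≋ 𝟎)) where

    e≉𝟎 : ∀ i → ¬ (e i ≋ 𝟎)
    e≉𝟎 i h = sq≉𝟎 i (≋-trans (·-congʳ h) (·-zeroˡ _))

    SignCommutes : Mat n n → Set ℓ
    SignCommutes w = ∀ i → e i · w ≋ w · e i ⊎ e i · w ≋ ⊖ (w · e i)

    sc-≋ : ∀ {v w} → v ≋ w → SignCommutes v → SignCommutes w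
    sc-≋ h sc i with sc i
    ... | inj₁ p = inj₁ (≋-trans (·-congˡ (≋-sym h)) (≋-trans p (·-congʳ h)))
    ... | inj₂ p = inj₂ (≋-trans (·-congˡ (≋-sym h)) (≋-trans p (⊖-cong (·-congʳ h))))

    sc-e : ∀ j → SignCommutes (e j)
    sc-e j i with i FinP.≟ j
    ... | yes ≡.refl = inj₁ ≋-refl
    ... | no i≢j     = inj₂ (anti i j i≢j)

    sc-· : ∀ {v w} → SignCommutes v → SignCommutes w → SignCommutes (v · w)
    sc-· {v} {w} p q i with p i | q i
    ... | inj₁ p | inj₁ q = inj₁ (begin
      e i · v · w        ≈⟨ ·-assoc _ _ _ ⟨
      (e i · v) · w      ≈⟨ ·-congʳ p ⟩
      (v · e i) · w      ≈⟨ ·-assoc _ _ _ ⟩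
      v · e i · w        ≈⟨ ·-congˡ q ⟩
      v · w · e i        ≈⟨ ·-assoc _ _ _ ⟨
      (v · w) · e i      ∎)
    ... | inj₁ p | inj₂ q = inj₂ (begin
      e i · v · w        ≈⟨ ·-assoc _ _ _ ⟨
      (e i · v) · w      ≈⟨ ·-congʳ p ⟩
      (v · e i) · w      ≈⟨ ·-assoc _ _ _ ⟩
      v · e i · w        ≈⟨ ·-congˡ q ⟩
      v · ⊖ (w · e i)    ≈⟨ ⊖-·ʳ _ _ ⟩
      ⊖ (v · w · e i)    ≈⟨ ⊖-cong (·-assoc _ _ _) ⟨
      ⊖ ((v · w) · e i)  ∎)
    ... | inj₂ p | inj₁ q = inj₂ (begin
      e i · v · w        ≈⟨ ·-assoc _ _ _ ⟨
      (e i · v) · w      ≈⟨ ·-congʳ p ⟩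
      (⊖ (v · e i)) · w  ≈⟨ ⊖-·ˡ _ _ ⟩
      ⊖ ((v · e i) · w)  ≈⟨ ⊖-cong (·-assoc _ _ _) ⟩
      ⊖ (v · e i · w)    ≈⟨ ⊖-cong (·-congˡ q) ⟩
      ⊖ (v · w · e i)    ≈⟨ ⊖-cong (·-assoc _ _ _) ⟨
      ⊖ ((v · w) · e i)  ∎)
    ... | inj₂ p | inj₂ q = inj₁ (begin
      e i · v · w          ≈⟨ ·-assoc _ _ _ ⟨
      (e i · v) · w        ≈⟨ ·-congʳ p ⟩
      (⊖ (v · e i)) · w    ≈⟨ ⊖-·ˡ _ _ ⟩
      ⊖ ((v · e i) · w)    ≈⟨ ⊖-cong (·-assoc _ _ _) ⟩
      ⊖ (v · e i · w)      ≈⟨ ⊖-cong (·-congˡ q) ⟩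
      ⊖ (v · ⊖ (w · e i))  ≈⟨ ⊖-cong (⊖-·ʳ _ _) ⟩
      ⊖ ⊖ (v · w · e i)    ≈⟨ ⊖-involutive _ ⟩
      v · w · e i          ≈⟨ ·-assoc _ _ _ ⟨
      (v · w) · e i        ∎)

    sc-zero : ∀ {w i} → SignCommutes w → e i · w ≋ 𝟎 → w · e i ≋ 𝟎
    sc-zero {w} {i} sc h with sc i
    ... | inj₁ p = ≋-trans (≋-sym p) h
    ... | inj₂ p = ≋-trans (≋-sym (⊖-involutive _)) (≋-trans (⊖-cong (≋-trans (≋-sym p) h)) ⊖-𝟎)

    record Candidate : Set (c ⊔ ℓ) where
      field
        {w}  : Mat n n
        sc   : SignCommutes w
        w≉𝟎  : ¬ (w ≋ 𝟎)
        full : FullFactorisation w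
      open FullFactorisation full public

    open Candidate using (rank)

    Minimal : Candidate → Set (c ⊔ ℓ)
    Minimal v = ∀ v′ → rank v ≤ rank v′

    -- Descent on the rank. Whether a candidate of smaller rank exists cannot be decided, so a
    -- minimum is obtained only up to double negation.
    minimal-candidate : Candidate → ¬ ¬ (∃[ v ] Minimal v)
    minimal-candidate v none = <-rec (λ d → ∀ v → rank v ≡ d → ⊥) step (rank v) v ≡.refl
      where
      step : ∀ d → (∀ {d′} → d′ < d → ∀ v → rank v ≡ d′ → ⊥) → ∀ v → rank v ≡ d → ⊥
      step _ rec v ≡.refl = none (v , λ v′ → ℕP.≮⇒≥ λ v′<v → rec v′<v v′ ≡.refl)

    compress : ∀ {d} (L : Mat d n) (R : Mat n d) → Fin k → Mat d d
    compress L R i = L · e i · R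

    -- Compression is not multiplicative in general. The two hypotheses supply this where it holds:
    -- `ε·ε` on the image of w, `η·η` on the kernel of the projection.
    compress-anti : ∀ {d} (L : Mat d n) (R : Mat n d) {i j} →
      compress L R i · compress L R j ≋ L · (e i · e j) · R →
      compress L R j · compress L R i ≋ L · (e j · e i) · R →
      i ≢ j → compress L R i · compress L R j ≋ ⊖ (compress L R j · compress L R i)
    compress-anti L R {i} {j} p q i≢j = begin
      compress L R i · compress L R j      ≈⟨ p ⟩
      L · (e i · e j) · R                  ≈⟨ ·-congˡ (·-congʳ (anti i j i≢j)) ⟩
      L · (⊖ (e j · e i)) · R              ≈⟨ ·-congˡ (⊖-·ˡ _ _) ⟩
      L · ⊖ ((e j · e i) · R)              ≈⟨ ⊖-·ʳ _ _ ⟩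
      ⊖ (L · (e j · e i) · R)              ≈⟨ ⊖-cong q ⟨
      ⊖ (compress L R j · compress L R i)  ∎

    module Step (IH : ∀ {m} → m < n → ∀ {l} (f : Fin l → Mat m m) → Anticommuting f →
                      (∀ i → ¬ (f i · f i ≋ 𝟎)) → l ≤ α-value m)
                (v : Candidate) (min : Minimal v) where
      open Candidate v hiding (rank)
      d : ℕ
      d = rank v

      d≤n : d ≤ n
      d≤n = left-inverse⇒≤ B⁻B

      1≤d : 1 ≤ d
      1≤d = ℕP.≮⇒≥ λ { (s≤s d≤0) → w≉𝟎 (≋-trans factor (·-empty B C d≤0)) }

      -- B T C has the same rank as T, because B and C have full rank. As a nonzero candidate it has
      -- rank at least d, so the d × d matrix T is regular. It is applied to T = `ε i` and to T = C
      -- B.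
      invertible-middle : (T : Mat d d) → SignCommutes (B · T · C) → ¬ (B · T · C ≋ 𝟎) → ¬ ¬ Invertible T
      invertible-middle T scT BTC≉𝟎 = do
        ff ← full-factorisation T
        return (invertible-if-rank≥ ff (min (extend-candidate ff)))
        where
        extend-candidate : FullFactorisation T → Candidate
        extend-candidate ff = record { sc = scT ; w≉𝟎 = BTC≉𝟎 ; full = record
          { B = B · T.B ; C = T.C · C ; B⁻ = T.B⁻ · B⁻ ; C⁻ = C⁻ · T.C⁻
          ; factor = begin
              B · T · C                ≈⟨ ·-congˡ (·-congʳ T.factor) ⟩
              B · (T.B · T.C) · C      ≈⟨ ·-congˡ (·-assoc _ _ _) ⟩
              B · T.B · T.C · C        ≈⟨ ·-assoc _ _ _ ⟨
              (B · T.B) · T.C · C      ∎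
          ; B⁻B = begin
              (T.B⁻ · B⁻) · B · T.B    ≈⟨ ·-assoc _ _ _ ⟩
              T.B⁻ · B⁻ · B · T.B      ≈⟨ ·-congˡ (cancelˡ B⁻B T.B) ⟩
              T.B⁻ · T.B               ≈⟨ T.B⁻B ⟩
              𝟏                        ∎
          ; CC⁻ = begin
              (T.C · C) · C⁻ · T.C⁻    ≈⟨ ·-assoc _ _ _ ⟩
              T.C · C · C⁻ · T.C⁻      ≈⟨ ·-congˡ (cancelˡ CC⁻ T.C⁻) ⟩
              T.C · T.C⁻               ≈⟨ T.CC⁻ ⟩
              𝟏                        ∎
          } }
          where module T = FullFactorisation ff

      ε : Fin k → Mat d d
      ε = compress B⁻ B

      -- The image of w is invariant: e i B = e i w C⁻ = ± w e i C⁻, which has the form B Z, and B⁻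
      -- then identifies Z as `ε i`.
      eB : ∀ i → e i · B ≋ B · ε i
      eB i = let Z , h = image in begin
        e i · B                ≈⟨ h ⟩
        B · Z                  ≈⟨ ·-congˡ (cancelˡ B⁻B Z) ⟨
        B · B⁻ · B · Z         ≈⟨ ·-congˡ (·-congˡ h) ⟨
        B · B⁻ · e i · B       ∎
        where
        eB-via-w : e i · B ≋ (e i · w) · C⁻
        eB-via-w = begin
          e i · B                ≈⟨ ·-congˡ (·-identityʳ B) ⟨
          e i · B · 𝟏            ≈⟨ ·-congˡ (·-congˡ CC⁻) ⟨
          e i · B · C · C⁻       ≈⟨ ·-congˡ (·-assoc _ _ _) ⟨
          e i · (B · C) · C⁻     ≈⟨ ·-congˡ (·-congʳ factor) ⟨
          e i · w · C⁻           ≈⟨ ·-assoc _ _ _ ⟨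
          (e i · w) · C⁻         ∎
        we : (w · e i) · C⁻ ≋ B · C · e i · C⁻
        we = ≋-trans (·-assoc _ _ _) (≋-trans (·-congʳ factor) (·-assoc _ _ _))
        image : ∃[ Z ] e i · B ≋ B · Z
        image with sc i
        ... | inj₁ p = C · e i · C⁻ , ≋-trans eB-via-w (≋-trans (·-congʳ p) we)
        ... | inj₂ p = ⊖ (C · e i · C⁻) , ≋-trans eB-via-w (≋-trans (·-congʳ p)
                         (≋-trans (⊖-·ˡ _ _) (≋-trans (⊖-cong we) (≋-sym (⊖-·ʳ _ _)))))

      ew : ∀ i → e i · w ≋ B · ε i · C
      ew i = begin
        e i · w          ≈⟨ ·-congˡ factor ⟩
        e i · B · C      ≈⟨ ·-assoc _ _ _ ⟨
        (e i · B) · C    ≈⟨ ·-congʳ (eB i) ⟩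
        (B · ε i) · C    ≈⟨ ·-assoc _ _ _ ⟩
        B · ε i · C      ∎

      ε·ε : ∀ i j → ε i · ε j ≋ B⁻ · (e i · e j) · B
      ε·ε i j = begin
        (B⁻ · e i · B) · ε j      ≈⟨ ·-assoc _ _ _ ⟩
        B⁻ · (e i · B) · ε j      ≈⟨ ·-congˡ (·-assoc _ _ _) ⟩
        B⁻ · e i · B · ε j        ≈⟨ ·-congˡ (·-congˡ (eB j)) ⟨
        B⁻ · e i · e j · B        ≈⟨ ·-congˡ (·-assoc _ _ _) ⟨
        B⁻ · (e i · e j) · B      ∎

      Kills Acts : Fin k → Set ℓ
      Kills i = e i · w ≋ 𝟎
      Acts i  = ¬ (ε i · ε i ≋ 𝟎)

      -- If e i w = B (ε i) C is nonzero, minimality makes `ε i` invertible; a zero square would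
      -- then force `ε i` and e i w to be zero.
      dichotomy : ∀ i → ¬ ¬ (Acts i ⊎ Kills i)
      dichotomy i = do
        no ew≉𝟎 ← ¬¬-excluded-middle {A = Kills i}
          where yes ew≋𝟎 → return (inj₂ ew≋𝟎)
        (X , Xε , _) ← invertible-middle (ε i) (sc-≋ (ew i) (sc-· (sc-e i) sc)) (λ h → ew≉𝟎 (≋-trans (ew i) h))
        return (inj₁ λ h → ew≉𝟎 (≋-trans (ew i) (≋-trans (·-congˡ (≋-trans (·-congʳ (injectiveˡ-𝟎 Xε h)) (·-zeroˡ C))) (·-zeroʳ B))))

      acts-bound : d < n → ∀ {l} (σ : Fin l → Fin k) → (∀ {i j} → σ i ≡ σ j → i ≡ j) → (∀ i → Acts (σ i)) → l ≤ α-value d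
      acts-bound d<n σ σ-inj acts = IH d<n (ε ∘ σ)
        (λ i j i≢j → compress-anti B⁻ B (ε·ε _ _) (ε·ε _ _) (i≢j ∘ σ-inj)) acts

      eB≋𝟎 : ∀ {i} → Kills i → e i · B ≋ 𝟎
      eB≋𝟎 kill = injectiveʳ-𝟎 CC⁻ (≋-trans (·-assoc _ _ _) (≋-trans (·-congˡ (≋-sym factor)) kill))

      Ce≋𝟎 : ∀ {i} → Kills i → C · e i ≋ 𝟎
      Ce≋𝟎 kill = injectiveˡ-𝟎 B⁻B (≋-trans (≋-sym (·-assoc _ _ _)) (≋-trans (·-congʳ (≋-sym factor)) (sc-zero sc kill)))

      ww : w · w ≋ B · (C · B) · C
      ww = ≋-trans (·-cong factor factor) (≋-trans (·-assoc _ _ _) (·-congˡ (≋-sym (·-assoc _ _ _))))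

      module Nilpotent (ww≋𝟎 : w · w ≋ 𝟎) where
        CB : C · B ≋ 𝟎
        CB = injectiveʳ-𝟎 CC⁻ (injectiveˡ-𝟎 B⁻B (≋-trans (≋-sym ww) ww≋𝟎))

        -- B⁻ is changed by a multiple of C so as to kill the columns of C⁻. Since C B = 0, it
        -- remains a left inverse of B.
        B⁺ : Mat d n
        B⁺ = B⁻ ⊕ ⊖ ((B⁻ · C⁻) · C)

        B⁺-· : ∀ {m} (Y : Mat n m) → B⁺ · Y ≋ B⁻ · Y ⊕ ⊖ ((B⁻ · C⁻) · C · Y)
        B⁺-· Y = ≋-trans (·-distribʳ Y _ _) (⊕-congˡ (≋-trans (⊖-·ˡ _ _) (⊖-cong (·-assoc _ _ _))))

        B⁺B : B⁺ · B ≋ 𝟏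
        B⁺B = begin
          B⁺ · B                            ≈⟨ B⁺-· B ⟩
          B⁻ · B ⊕ ⊖ ((B⁻ · C⁻) · C · B)    ≈⟨ ⊕-cong B⁻B (⊖-cong (≋-trans (·-congˡ CB) (·-zeroʳ _))) ⟩
          𝟏 ⊕ ⊖ 𝟎                           ≈⟨ ≋-trans (⊕-congˡ ⊖-𝟎) (⊕-identityʳ 𝟏) ⟩
          𝟏                                 ∎

        B⁺C⁻ : B⁺ · C⁻ ≋ 𝟎
        B⁺C⁻ = begin
          B⁺ · C⁻                           ≈⟨ B⁺-· C⁻ ⟩
          B⁻ · C⁻ ⊕ ⊖ ((B⁻ · C⁻) · C · C⁻)  ≈⟨ ⊕-congˡ (⊖-cong (≋-trans (·-congˡ CC⁻) (·-identityʳ _))) ⟩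
          B⁻ · C⁻ ⊕ ⊖ (B⁻ · C⁻)             ≈⟨ ⊕-inverseʳ _ ⟩
          𝟎                                 ∎

        -- The projection onto the image of w plus the column space of C⁻, a complement of ker w.
        -- These are 2d independent columns, and the kernel of E is a copy of ker w / im w.
        E : Mat n n
        E = B · B⁺ ⊕ C⁻ · C

        E-· : ∀ {m} (Y : Mat n m) → E · Y ≋ B · B⁺ · Y ⊕ C⁻ · C · Y
        E-· Y = ≋-trans (·-distribʳ Y _ _) (⊕-cong (·-assoc _ _ _) (·-assoc _ _ _))

        EB : E · B ≋ B
        EB = ≋-trans (E-· B) (≋-trans (⊕-cong (≋-trans (·-congˡ B⁺B) (·-identityʳ B)) (≋-trans (·-congˡ CB) (·-zeroʳ C⁻))) (⊕-identityʳ B))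

        EC⁻ : E · C⁻ ≋ C⁻
        EC⁻ = ≋-trans (E-· C⁻) (≋-trans (⊕-cong (≋-trans (·-congˡ B⁺C⁻) (·-zeroʳ B)) (≋-trans (·-congˡ CC⁻) (·-identityʳ C⁻))) (⊕-identityˡ C⁻))

        EE : E · E ≋ E
        EE = ≋-trans (·-distribˡ E _ _) (⊕-cong (≋-trans (≋-sym (·-assoc _ _ _)) (·-congʳ EB)) (≋-trans (≋-sym (·-assoc _ _ _)) (·-congʳ EC⁻)))

        independent : ∀ c₁ c₂ → B · c₁ ⊕ C⁻ · c₂ ≋ 𝟎 {n} {1} → c₁ ≋ 𝟎 × c₂ ≋ 𝟎
        independent c₁ c₂ h = c₁≋𝟎 , injectiveˡ-𝟎 CC⁻ (begin
            C⁻ · c₂            ≈⟨ ⊕-identityˡ _ ⟨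
            𝟎 ⊕ C⁻ · c₂        ≈⟨ ⊕-congʳ (≋-trans (·-congˡ c₁≋𝟎) (·-zeroʳ B)) ⟨
            B · c₁ ⊕ C⁻ · c₂   ≈⟨ h ⟩
            𝟎                  ∎)
          where
          c₁≋𝟎 : c₁ ≋ 𝟎
          c₁≋𝟎 = begin
            c₁                                ≈⟨ cancelˡ B⁺B c₁ ⟨
            B⁺ · B · c₁                       ≈⟨ ⊕-identityʳ _ ⟨
            B⁺ · B · c₁ ⊕ 𝟎                   ≈⟨ ⊕-congˡ (≋-trans (≋-sym (·-assoc _ _ _)) (≋-trans (·-congʳ B⁺C⁻) (·-zeroˡ c₂))) ⟨
            B⁺ · B · c₁ ⊕ B⁺ · C⁻ · c₂        ≈⟨ ·-distribˡ B⁺ _ _ ⟨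
            B⁺ · (B · c₁ ⊕ C⁻ · c₂)           ≈⟨ ·-congˡ h ⟩
            B⁺ · 𝟎                            ≈⟨ ·-zeroʳ B⁺ ⟩
            𝟎                                 ∎

        2d≤n : ∀ (cpl : Complement E) → (d ℕ.+ d) ℕ.+ Complement.corank cpl ≤ n
        2d≤n cpl = Complement.corank-≤ cpl (B ∣ C⁻) (≋-trans (·-∣ E B C⁻) (∣-cong EB EC⁻)) (∣-injective B C⁻ independent)

        kills-bound : (cpl : Complement E) → ∀ {l} (σ : Fin l → Fin k) → (∀ {i j} → σ i ≡ σ j → i ≡ j) →
          (∀ i → Kills (σ i)) → l ≤ Complement.corank cpl ℕ.+ Complement.corank cpl
        kills-bound cpl σ σ-inj kills = bilinear-bound (e ∘ σ) (λ i j i≢j → anti _ _ (i≢j ∘ σ-inj)) (sq≉𝟎 ∘ σ)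
          (λ i → e (σ i) · K.B) (λ j → K.C · e (σ j)) λ i j → factors (kills i) (kills j)
          where
          module K = Complement cpl
          -- Insert E + K.B K.C = 𝟏 between e i and e j: the E part vanishes because e i B = 0 and C
          -- e j = 0, so the product passes through the kernel of E.
          factors : ∀ {i j} → Kills i → Kills j → e i · e j ≋ (e i · K.B) · K.C · e j
          factors {i} {j} ki kj = begin
            e i · e j                                ≈⟨ ·-congˡ (·-identityˡ (e j)) ⟨
            e i · 𝟏 · e j                            ≈⟨ ·-congˡ (·-congʳ K.E⊕BC) ⟨
            e i · (E ⊕ K.B · K.C) · e j              ≈⟨ ·-congˡ (·-distribʳ _ _ _) ⟩
            e i · (E · e j ⊕ (K.B · K.C) · e j)      ≈⟨ ·-distribˡ _ _ _ ⟩
            e i · E · e j ⊕ e i · (K.B · K.C) · e j  ≈⟨ ⊕-cong eEe (·-congˡ (·-assoc _ _ _)) ⟩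
            𝟎 ⊕ e i · K.B · K.C · e j                ≈⟨ ⊕-identityˡ _ ⟩
            e i · K.B · K.C · e j                    ≈⟨ ·-assoc _ _ _ ⟨
            (e i · K.B) · K.C · e j                  ∎
            where
            eEe : e i · E · e j ≋ 𝟎
            eEe = begin
              e i · E · e j                              ≈⟨ ·-congˡ (E-· (e j)) ⟩
              e i · (B · B⁺ · e j ⊕ C⁻ · C · e j)        ≈⟨ ·-distribˡ _ _ _ ⟩
              e i · B · B⁺ · e j ⊕ e i · C⁻ · C · e j    ≈⟨ ⊕-cong
                  (≋-trans (≋-sym (·-assoc _ _ _)) (≋-trans (·-congʳ (eB≋𝟎 ki)) (·-zeroˡ _)))
                  (≋-trans (·-congˡ (≋-trans (·-congˡ (Ce≋𝟎 kj)) (·-zeroʳ C⁻))) (·-zeroʳ (e i))) ⟩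
              𝟎 ⊕ 𝟎                                      ≈⟨ ⊕-identityʳ 𝟎 ⟩
              𝟎                                          ∎

      module NonNilpotent (s : Mat d d) (sCB : s · C · B ≋ 𝟏) where
        -- With s the inverse of C B, this is the projection onto the image of w along its kernel.
        E : Mat n n
        E = B · s · C

        EB : E · B ≋ B
        EB = begin
          (B · s · C) · B    ≈⟨ ·-assoc _ _ _ ⟩
          B · (s · C) · B    ≈⟨ ·-congˡ (·-assoc _ _ _) ⟩
          B · s · C · B      ≈⟨ ·-congˡ sCB ⟩
          B · 𝟏              ≈⟨ ·-identityʳ B ⟩
          B                  ∎

        EE : E · E ≋ E
        EE = ≋-trans (≋-sym (·-assoc _ _ _)) (·-congʳ EB)

        module _ (cpl : Complement E) where
          module K = Complement cpl

          d+corank≤n : d ℕ.+ K.corank ≤ n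
          d+corank≤n = K.corank-≤ B EB λ c → injectiveˡ-𝟎 B⁻B

          corank<n : K.corank < n
          corank<n = ℕP.≤-trans (ℕP.+-monoˡ-≤ K.corank 1≤d) d+corank≤n

          -- C e i = 0 gives E e i = 0, so e i has its image in ker w; dually, `right` uses e i B =
          -- 0. Such an e i lives entirely on the kernel of E.
          left : ∀ {i} → Kills i → K.B · K.C · e i ≋ e i
          left {i} ki = begin
            K.B · K.C · e i                 ≈⟨ ⊕-identityˡ _ ⟨
            𝟎 ⊕ K.B · K.C · e i             ≈⟨ ⊕-cong (≋-trans (·-assoc _ _ _) (≋-trans (·-congˡ (≋-trans (·-assoc _ _ _)
                                                 (≋-trans (·-congˡ (Ce≋𝟎 ki)) (·-zeroʳ s)))) (·-zeroʳ B))) (·-assoc _ _ _) ⟨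
            E · e i ⊕ (K.B · K.C) · e i     ≈⟨ ·-distribʳ _ _ _ ⟨
            (E ⊕ K.B · K.C) · e i           ≈⟨ ·-congʳ K.E⊕BC ⟩
            𝟏 · e i                         ≈⟨ ·-identityˡ _ ⟩
            e i                             ∎

          right : ∀ {i} → Kills i → (e i · K.B) · K.C ≋ e i
          right {i} ki = begin
            (e i · K.B) · K.C               ≈⟨ ·-assoc _ _ _ ⟩
            e i · K.B · K.C                 ≈⟨ ⊕-identityˡ _ ⟨
            𝟎 ⊕ e i · K.B · K.C             ≈⟨ ⊕-congʳ (≋-trans (≋-sym (·-assoc _ _ _)) (≋-trans (·-congʳ (eB≋𝟎 ki)) (·-zeroˡ _))) ⟨
            e i · E ⊕ e i · K.B · K.C       ≈⟨ ·-distribˡ _ _ _ ⟨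
            e i · (E ⊕ K.B · K.C)           ≈⟨ ·-congˡ K.E⊕BC ⟩
            e i · 𝟏                         ≈⟨ ·-identityʳ _ ⟩
            e i                             ∎

          η : Fin k → Mat K.corank K.corank
          η = compress K.C K.B

          η·η : ∀ {i j} → Kills j → η i · η j ≋ K.C · (e i · e j) · K.B
          η·η {i} {j} kj = begin
            (K.C · e i · K.B) · K.C · e j · K.B    ≈⟨ ·-assoc _ _ _ ⟩
            K.C · (e i · K.B) · K.C · e j · K.B    ≈⟨ ·-congˡ (·-assoc _ _ _) ⟩
            K.C · e i · K.B · K.C · e j · K.B      ≈⟨ ·-congˡ (·-congˡ (≋-trans (≋-sym (·-congˡ (·-assoc _ _ _))) (≋-sym (·-assoc _ _ _)))) ⟩
            K.C · e i · (K.B · K.C · e j) · K.B    ≈⟨ ·-congˡ (·-congˡ (·-congʳ (left kj))) ⟩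
            K.C · e i · e j · K.B                  ≈⟨ ·-congˡ (·-assoc _ _ _) ⟨
            K.C · (e i · e j) · K.B                ∎

          -- By `left` and `right`, e i² equals K.B (η i)² K.C, so compressing cannot make a nonzero
          -- square vanish.
          η-square : ∀ {i} → Kills i → ¬ (η i · η i ≋ 𝟎)
          η-square {i} ki h = sq≉𝟎 i (begin
            e i · e i                                  ≈⟨ ·-cong (left ki) (right ki) ⟨
            (K.B · K.C · e i) · (e i · K.B) · K.C      ≈⟨ ·-assoc _ _ _ ⟩
            K.B · (K.C · e i) · (e i · K.B) · K.C      ≈⟨ ·-congˡ (·-assoc _ _ _) ⟩
            K.B · K.C · e i · (e i · K.B) · K.C        ≈⟨ ·-congˡ (·-congˡ (≋-trans (≋-sym (·-assoc _ _ _)) (·-congʳ (≋-sym (·-assoc _ _ _))))) ⟩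
            K.B · K.C · ((e i · e i) · K.B) · K.C      ≈⟨ ·-congˡ (·-assoc _ _ _) ⟨
            K.B · (K.C · (e i · e i) · K.B) · K.C      ≈⟨ ·-congˡ (·-congʳ (≋-trans (≋-sym (η·η ki)) h)) ⟩
            K.B · 𝟎 · K.C                              ≈⟨ ≋-trans (·-congˡ (·-zeroˡ _)) (·-zeroʳ _) ⟩
            𝟎                                          ∎)

          kills-bound : ∀ {l} (σ : Fin l → Fin k) → (∀ {i j} → σ i ≡ σ j → i ≡ j) →
            (∀ i → Kills (σ i)) → l ≤ α-value K.corank
          kills-bound σ σ-inj kills = IH corank<n (η ∘ σ)
            (λ i j i≢j → compress-anti K.C K.B (η·η (kills j)) (η·η (kills i)) (i≢j ∘ σ-inj)) (η-square ∘ kills)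

      singular-bound : d < n → ¬ ¬ (k ≤ α-value n)
      singular-bound d<n = do
        types ← ¬¬-∀Fin dichotomy
        let open Partition (partition types)
        no ww≉𝟎 ← ¬¬-excluded-middle {A = w · w ≋ 𝟎}
          where
          yes ww≋𝟎 → do
            cpl ← complement (Nilpotent.EE ww≋𝟎)
            return (ℕP.≤-trans (ℕP.≤-reflexive (≡.sym m+n≡k)) (ℕP.≤-trans
              (ℕP.+-mono-≤ (acts-bound d<n f f-injective P-f) (Nilpotent.kills-bound ww≋𝟎 cpl g g-injective Q-g))
              (α-value-nilpotent 1≤d (Nilpotent.2d≤n ww≋𝟎 cpl))))
        (s , sCB , _) ← invertible-middle (C · B) (sc-≋ ww (sc-· sc sc)) (λ h → ww≉𝟎 (≋-trans ww h))
        cpl ← complement (NonNilpotent.EE s sCB)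
        return (ℕP.≤-trans (ℕP.≤-reflexive (≡.sym m+n≡k)) (ℕP.≤-trans
          (ℕP.+-mono-≤ (acts-bound d<n f f-injective P-f) (NonNilpotent.kills-bound s sCB cpl g g-injective Q-g))
          (α-value-split {d} (NonNilpotent.d+corank≤n s sCB cpl))))

      invertible-all : n ≤ d → ∀ i → ¬ ¬ Invertible (e i)
      invertible-all n≤d i = do
        ff ← full-factorisation (e i)
        return (invertible-if-rank≥ ff (ℕP.≤-trans n≤d (min record { sc = sc-e i ; w≉𝟎 = e≉𝟎 i ; full = ff })))

      regular-bound : n ≤ d → ¬ ¬ (k ≤ α-value n)
      regular-bound n≤d = do
        inv ← ¬¬-∀Fin (invertible-all n≤d)
        return (bound inv)
        where
        scalars-commute : n ≡ 1 → ∀ (A B : Mat n n) → A · B ≋ B · A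
        scalars-commute ≡.refl A B = entries λ { zero zero → trans (reflexive (·-entry A B zero zero))
          (trans (+-congʳ (*-comm _ _)) (reflexive (≡.sym (·-entry B A zero zero)))) }

        bound : (∀ i → Invertible (e i)) → k ≤ α-value n
        -- For n = 1 the count would allow two matrices. There all matrices commute, so distinct
        -- indices would give 2 e i e j = 0, which invertibility excludes.
        bound inv with n ℕP.≟ 1
        ... | no n≢1 = tri≤n*n⇒≤α-value (ℕP.≤∧≢⇒< (ℕP.≤-trans 1≤d d≤n) (n≢1 ∘ ≡.sym)) (invertible-bound e anti inv e≉𝟎)
        ... | yes n≡1 = ≡.subst (λ n → k ≤ α-value n) (≡.sym n≡1) (FinP.injective⇒≤ {f = λ (_ : Fin k) → zero {0}} λ {i} {j} _ → same i j)
          where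
          same : ∀ i j → i ≡ j
          same i j with i FinP.≟ j
          ... | yes i≡j = i≡j
          ... | no i≢j  = contradiction
            (injectiveˡ-𝟎 (proj₁ (proj₂ (inv i))) (A⊕A≋𝟎⇒A≋𝟎 (≋-trans (⊕-congˡ
              (≋-trans (anti i j i≢j) (⊖-cong (scalars-commute n≡1 _ _)))) (⊕-inverseʳ _)))) (e≉𝟎 j)

      bound : ¬ ¬ (k ≤ α-value n)
      bound with d ℕP.<? n
      ... | yes d<n = singular-bound d<n
      ... | no d≮n  = regular-bound (ℕP.≮⇒≥ d≮n)

  anticommuting-bound : ∀ n {k} (e : Fin k → Mat n n) → Anticommuting e →
    (∀ i → ¬ (e i · e i ≋ 𝟎)) → k ≤ α-value n
  anticommuting-bound = <-rec _ step
    where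
    step : ∀ n → (∀ {m} → m < n → ∀ {l} (f : Fin l → Mat m m) → Anticommuting f →
                   (∀ i → ¬ (f i · f i ≋ 𝟎)) → l ≤ α-value m) →
           ∀ {k} (e : Fin k → Mat n n) → Anticommuting e → (∀ i → ¬ (e i · e i ≋ 𝟎)) → k ≤ α-value n
    step n IH {zero}  e anti sq≉𝟎 = z≤n
    step n IH {suc k} e anti sq≉𝟎 = decidable-stable (suc k ℕP.≤? α-value n) do
      ff        ← full-factorisation (e zero)
      (v , min) ← U.minimal-candidate record { sc = U.sc-e zero ; w≉𝟎 = U.e≉𝟎 zero ; full = ff }
      U.Step.bound IH v min
      where module U = Upper e anti sq≉𝟎

-- Lower bound: the family of 2m + 1 matrices in dimension m + 2

module LowerBound {c ℓ} (R : CommutativeRing c ℓ) where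
  open Matrices R

  module _ {m : ℕ} where

    -- With basis x, y, b₀, …, bₘ₋₁: the matrix E l s sends y to s b_l and b_l to x,
    -- and D is -1 on x, y and 1 on the b_l.
    E : Fin m → Carrier → Mat (2 ℕ.+ m) (2 ℕ.+ m)
    E l s zero          (suc (suc j)) = 𝟏 l j
    E l s (suc (suc i)) (suc zero)    = 𝟏 l i * s
    E l s _             _             = 0#

    sign : Fin (2 ℕ.+ m) → Carrier
    sign zero          = - 1#
    sign (suc zero)    = - 1#
    sign (suc (suc _)) = 1#

    D : Mat (2 ℕ.+ m) (2 ℕ.+ m)
    D i j = sign i * 𝟏 i j

    corner : Carrier → Mat (2 ℕ.+ m) (2 ℕ.+ m)
    corner t zero (suc zero) = t
    corner t _    _          = 0#

    -- Going from y through s′ b_l′ to x survives only for l = l′. Hence different l give zero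
    -- products, while for equal l the two orders give s′ and s in the corner: opposite signs
    -- anticommute, and the squares are nonzero.
    E·E : ∀ l s l′ s′ → E l s · E l′ s′ ≋ corner (𝟏 l′ l * s′)
    E·E l s l′ s′ = entries λ i j → trans (reflexive (·-entry (E l s) (E l′ s′) i j)) (go i j)
      where
      vanish : ∀ i j → (∀ x → E l s i x * E l′ s′ x j ≈ 0#) → sum (λ x → E l s i x * E l′ s′ x j) ≈ 0#
      vanish i j h = sum-zero h
      go : ∀ i j → sum (λ x → E l s i x * E l′ s′ x j) ≈ corner (𝟏 l′ l * s′) i j
      go zero zero = vanish zero zero λ { zero → zeroˡ _ ; (suc zero) → zeroˡ _ ; (suc (suc x)) → zeroʳ _ }
      go zero (suc zero) = trans (+-cong (zeroˡ _) (+-congʳ (zeroˡ _)))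
        (trans (+-identityˡ _) (trans (+-identityˡ _) (𝟏-row l (λ x → 𝟏 l′ x * s′))))
      go zero (suc (suc j)) = vanish zero (suc (suc j)) λ { zero → zeroˡ _ ; (suc zero) → zeroˡ _ ; (suc (suc x)) → zeroʳ _ }
      go (suc zero) j = vanish (suc zero) j λ { zero → zeroˡ _ ; (suc zero) → zeroˡ _ ; (suc (suc x)) → zeroˡ _ }
      go (suc (suc i)) j = vanish (suc (suc i)) j λ { zero → zeroˡ _ ; (suc zero) → zeroʳ _ ; (suc (suc x)) → zeroˡ _ }

    D·-entry : ∀ (A : Mat (2 ℕ.+ m) (2 ℕ.+ m)) i j → (D · A) i j ≈ sign i * A i j
    D·-entry A i j = trans (reflexive (·-entry D A i j)) (trans (sum-cong-≋ λ x → *-assoc (sign i) (𝟏 i x) (A x j))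
      (trans (sym (*-distribˡ-sum (sign i) (λ x → 𝟏 i x * A x j))) (*-congˡ (𝟏-row i (λ x → A x j)))))

    ·D-entry : ∀ (A : Mat (2 ℕ.+ m) (2 ℕ.+ m)) i j → (A · D) i j ≈ A i j * sign j
    ·D-entry A i j = trans (reflexive (·-entry A D i j)) (trans
      (sum-cong-≋ λ x → trans (*-comm (A i x) _) (trans (*-congʳ (trans (*-congˡ (reflexive (𝟏-sym x j))) (flip x)))
        (*-assoc (𝟏 j x) (sign j) (A i x)))) (trans (𝟏-row j (λ x → sign j * A i x)) (*-comm _ _)))
      where
      flip : ∀ x → sign x * 𝟏 j x ≈ 𝟏 j x * sign j
      flip x with j FinP.≟ x
      ... | yes ≡.refl = *-comm _ _
      ... | no j≢x = trans (trans (*-congˡ (𝟏-off-diagonal j x j≢x)) (zeroʳ _)) (sym (trans (*-congʳ (𝟏-off-diagonal j x j≢x)) (zeroˡ _)))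

    -- `E l s` maps each of the two eigenspaces of D, spanned by x, y and by the b's, into the other
    -- one.
    D·E : ∀ l s → D · E l s ≋ ⊖ (E l s · D)
    D·E l s = entries λ i j → trans (D·-entry (E l s) i j) (trans (go i j) (-‿cong (sym (·D-entry (E l s) i j))))
      where
      zeros : ∀ {x y} → x * 0# ≈ - (0# * y)
      zeros = trans (zeroʳ _) (sym (trans (-‿cong (zeroˡ _)) -0#≈0#))
      go : ∀ i j → sign i * E l s i j ≈ - (E l s i j * sign j)
      go zero zero = zeros
      go zero (suc zero) = zeros
      go zero (suc (suc j)) = trans (*-comm _ _) (sym (-‿distribʳ-* _ _))
      go (suc zero) j = zeros
      go (suc (suc i)) zero = zeros
      go (suc (suc i)) (suc zero) = trans (*-comm _ _) (trans (sym (-‿involutive _)) (-‿cong (-‿distribʳ-* _ _)))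
      go (suc (suc i)) (suc (suc j)) = zeros

    family : Fin (suc (m ℕ.+ m)) → Mat (2 ℕ.+ m) (2 ℕ.+ m)
    family zero    = D
    family (suc x) with splitAt m x
    ... | inj₁ l = E l 1#
    ... | inj₂ l = E l (- 1#)

    corner-cong : ∀ {s t} → s ≈ t → corner s ≋ corner t
    corner-cong h = entries λ { zero zero → refl ; zero (suc zero) → h ; zero (suc (suc _)) → refl
                              ; (suc _) zero → refl ; (suc _) (suc zero) → refl ; (suc _) (suc (suc _)) → refl }

    corner-neg : ∀ {t} → corner (- t) ≋ ⊖ corner t
    corner-neg = entries λ { zero zero → n0 ; zero (suc zero) → refl ; zero (suc (suc _)) → n0
                           ; (suc _) zero → n0 ; (suc _) (suc zero) → n0 ; (suc _) (suc (suc _)) → n0 }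
      where n0 = sym -0#≈0#

    E-anti : ∀ l s l′ s′ → 𝟏 l′ l * s′ ≈ - (𝟏 l l′ * s) → E l s · E l′ s′ ≋ ⊖ (E l′ s′ · E l s)
    E-anti l s l′ s′ h = ≋-trans (E·E l s l′ s′) (≋-trans (corner-cong h) (≋-trans corner-neg (⊖-cong (≋-sym (E·E l′ s′ l s)))))

    E-anti-≢ : ∀ l s l′ s′ → l ≢ l′ → E l s · E l′ s′ ≋ ⊖ (E l′ s′ · E l s)
    E-anti-≢ l s l′ s′ l≢l′ = E-anti l s l′ s′ (trans
      (trans (*-congʳ (𝟏-off-diagonal l′ l λ e → l≢l′ (≡.sym e))) (zeroˡ s′))
      (sym (trans (-‿cong (trans (*-congʳ (𝟏-off-diagonal l l′ l≢l′)) (zeroˡ s))) -0#≈0#)))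

    E-anti-± : ∀ l l′ s s′ → s′ ≈ - s → E l s · E l′ s′ ≋ ⊖ (E l′ s′ · E l s)
    E-anti-± l l′ s s′ h = E-anti l s l′ s′ (trans (*-cong (reflexive (𝟏-sym l′ l)) h) (sym (-‿distribʳ-* _ _)))

    family-anti : ∀ i j → i ≢ j → family i · family j ≋ ⊖ (family j · family i)
    family-anti zero zero h = contradiction ≡.refl h
    family-anti zero (suc y) _ with splitAt m y
    ... | inj₁ l = D·E l 1#
    ... | inj₂ l = D·E l (- 1#)
    family-anti (suc x) zero _ with splitAt m x
    ... | inj₁ l = ≋-trans (≋-sym (⊖-involutive _)) (⊖-cong (≋-sym (D·E l 1#)))
    ... | inj₂ l = ≋-trans (≋-sym (⊖-involutive _)) (⊖-cong (≋-sym (D·E l (- 1#))))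
    family-anti (suc x) (suc y) h with splitAt m x | FinP.join-splitAt m m x | splitAt m y | FinP.join-splitAt m m y
    ... | inj₁ l | ≡.refl | inj₁ l′ | ≡.refl = E-anti-≢ l _ l′ _ λ { ≡.refl → h ≡.refl }
    ... | inj₁ l | ≡.refl | inj₂ l′ | ≡.refl = E-anti-± l l′ _ _ refl
    ... | inj₂ l | ≡.refl | inj₁ l′ | ≡.refl = E-anti-± l l′ _ _ (sym (-‿involutive 1#))
    ... | inj₂ l | ≡.refl | inj₂ l′ | ≡.refl = E-anti-≢ l _ l′ _ λ { ≡.refl → h ≡.refl }

    family-sq : ¬ (1# ≈ 0#) → ∀ i → ¬ (family i · family i ≋ 𝟎)
    family-sq 1≉0 zero h = 1≉0 (trans (sym (trans (D·-entry D zero zero) (trans (*-congˡ (*-identityʳ _))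
      (trans (sym (-‿distribˡ-* _ _)) (trans (-‿cong (*-identityˡ _)) (-‿involutive 1#)))))) (entry h zero zero))
    family-sq 1≉0 (suc x) h with splitAt m x
    ... | inj₁ l = 1≉0 (trans (sym (trans (entry (E·E l 1# l 1#) zero (suc zero)) (trans (*-congʳ (𝟏-diagonal l)) (*-identityˡ 1#)))) (entry h zero (suc zero)))
    ... | inj₂ l = 1≉0 (trans (sym (-‿involutive 1#)) (trans (-‿cong (trans (sym (trans (entry (E·E l (- 1#) l (- 1#)) zero (suc zero)) (trans (*-congʳ (𝟏-diagonal l)) (*-identityˡ _)))) (entry h zero (suc zero)))) -0#≈0#))

-- Passing between matrix conventions, and transfer from the rationals

module Families {c ℓ} (R : CommutativeRing c ℓ) where
  open Matrices R
  open SquareMatrix rawRing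
  private module ℚM = SquareMatrix ℚ.+-*-rawRing

  Family Family· : ℕ → ℕ → Set (c ⊔ ℓ)
  Family n k = Σ[ e ∈ (Fin k → Matrix n) ] ((∀ i j → i ≢ j → e i *ᴹ e j ≈ᴹ -ᴹ (e j *ᴹ e i)) × (∀ i → e i *ᴹ e i ≉ᴹ 0ᴹ))
  Family· n k = Σ[ e ∈ (Fin k → Mat n n) ] ((∀ i j → i ≢ j → e i · e j ≋ ⊖ (e j · e i)) × (∀ i → ¬ (e i · e i ≋ 𝟎)))

  *ᴹ≋· : ∀ {n} (A B : Matrix n) → A *ᴹ B ≋ A · B
  *ᴹ≋· A B = entries λ i j → reflexive (≡.sym (·-entry A B i j))

  Family⇒Family· : ∀ {n k} → Family n k → Family· n k
  Family⇒Family· (e , anti , sq) = e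
    , (λ i j i≢j → ≋-trans (≋-sym (*ᴹ≋· (e i) (e j))) (≋-trans (entries (anti i j i≢j)) (⊖-cong (*ᴹ≋· (e j) (e i)))))
    , λ i h → sq i (entry (≋-trans (*ᴹ≋· (e i) (e i)) h))

  Family·⇒Family : ∀ {n k} → Family· n k → Family n k
  Family·⇒Family (e , anti , sq) = e
    , (λ i j i≢j → entry (≋-trans (*ᴹ≋· (e i) (e j)) (≋-trans (anti i j i≢j) (⊖-cong (≋-sym (*ᴹ≋· (e j) (e i)))))))
    , λ i h → sq i (≋-trans (≋-sym (*ᴹ≋· (e i) (e i))) (entries h))

  -- Over ℚ both conditions are decidable, so small families are checked by computation; an
  -- injective ring map then carries them over, injectivity keeping the squares nonzero.
  Rational : ∀ {n k} → (Fin k → ℚM.Matrix n) → Set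
  Rational e = (∀ i j → i ≢ j → e i ℚM.*ᴹ e j ℚM.≈ᴹ ℚM.-ᴹ (e j ℚM.*ᴹ e i)) × (∀ i → e i ℚM.*ᴹ e i ℚM.≉ᴹ ℚM.0ᴹ)

  module _ (h : ℚ → Carrier) (h-+ : ∀ p q → h (p ℚ.+ q) ≈ h p + h q) (h-* : ∀ p q → h (p ℚ.* q) ≈ h p * h q)
           (h-neg : ∀ p → h (ℚ.- p) ≈ - h p) (h-0 : h 0ℚ ≈ 0#) (h-injective : ∀ {p q} → h p ≈ h q → p ≡ q) where

    open import Algebra.Definitions.RawMonoid ℚ.+-0-rawMonoid using () renaming (sum to sumℚ)

    h-sum : ∀ n (f g : Fin n → ℚ) → h (sumℚ (λ l → f l ℚ.* g l)) ≈ sum (λ l → h (f l) * h (g l))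
    h-sum zero    f g = h-0
    h-sum (suc n) f g = trans (h-+ _ _) (+-cong (h-* _ _) (h-sum n (λ l → f (suc l)) (λ l → g (suc l))))

    embed : ∀ {m} → ℚM.Matrix m → Matrix m
    embed A i j = h (A i j)

    embed-· : ∀ {n} (A B : ℚM.Matrix n) → embed (A ℚM.*ᴹ B) ≋ embed A · embed B
    embed-· A B = entries λ i j → trans (h-sum _ (A i) (λ l → B l j)) (reflexive (≡.sym (·-entry (embed A) (embed B) i j)))

    rational-family : ∀ {n k} (e : Fin k → ℚM.Matrix n) → Rational e → Family n k
    rational-family e (anti , sq≢0) = Family·⇒Family ((λ i → embed (e i))
      , (λ i j i≢j → ≋-trans (≋-sym (embed-· (e i) (e j)))
          (≋-trans (entries λ x y → trans (reflexive (≡.cong h (anti i j i≢j x y))) (h-neg _)) (⊖-cong (embed-· (e j) (e i)))))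
      , λ i z → sq≢0 i λ x y → h-injective (trans (entry (≋-trans (embed-· (e i) (e i)) z) x y) (sym h-0)))

-- The complex numbers as a classical field

module ComplexNumbers where
  open import Defs
  open import Data.Integer.Base using (+_)
  import Data.Integer.Properties as ℤP
  import Data.Nat.Coprimality as Coprime
  open import Data.Rational.Base using (_+_; _*_; _-_; -_; _<_; _≤_; ∣_∣; 1/_; positive; nonNegative; ≢-nonZero)
  open import Data.Rational.Properties
  open import Data.Rational.Solver using () renaming (module +-*-Solver to ℚ-Solver)
  open import Relation.Binary.PropositionalEquality using (refl; sym; trans; cong; cong₂; subst; subst₂)
  open ℚ-Solver using (solve; _:+_; _:*_; :-_; _:-_; _:=_; con)

  <⇒≱ : ∀ {p q} → p < q → ¬ (q ≤ p)
  <⇒≱ p<q q≤p = <-irrefl refl (<-≤-trans p<q q≤p)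

  -- x ≈ℝ y unfolds to `Null` of the sequence of differences, so congruence and stability of
  -- equality reduce to facts on null sequences.
  Null : (ℕ → ℚ) → Set
  Null x = ∀ ε → 0ℚ < ε → ∃[ N ] (∀ n → N ℕ.≤ n → ∣ x n ∣ < ε)

  0<½* : ∀ {ε} → 0ℚ < ε → 0ℚ < ½ * ε
  0<½* {ε} 0<ε = subst (_< ½ * ε) (*-zeroʳ ½) (*-monoʳ-<-pos ½ 0<ε)

  ½*+½* : ∀ ε → ½ * ε + ½ * ε ≡ ε
  ½*+½* ε = trans (sym (*-distribʳ-+ ε ½ ½)) (*-identityˡ ε)

  0<* : ∀ {p q} → 0ℚ < p → 0ℚ < q → 0ℚ < p * q
  0<* {p} {q} 0<p 0<q = subst (_< p * q) (*-zeroʳ p) (*-monoʳ-<-pos p {{positive 0<p}} 0<q)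

  0<⇒inverse : ∀ {p} → 0ℚ < p → ∃[ q ] (0ℚ < q × p * q ≡ 1ℚ)
  0<⇒inverse {p} 0<p = 1/ p , positive⁻¹ (1/ p) {{1/pos⇒pos p}} , *-inverseʳ p
    where instance
      _ = positive 0<p
      _ = pos⇒nonZero p

  null-≗ : ∀ {x y} → (∀ n → x n ≡ y n) → Null x → Null y
  null-≗ x≗y h ε 0<ε with N , small ← h ε 0<ε = N , λ n N≤n → subst (λ q → ∣ q ∣ < ε) (x≗y n) (small n N≤n)

  null-0 : Null (λ _ → 0ℚ)
  null-0 ε 0<ε = 0 , λ _ _ → 0<ε

  null-neg : ∀ {x} → Null x → Null (λ n → - x n)
  null-neg {x} h ε 0<ε with N , small ← h ε 0<ε =
    N , λ n N≤n → subst (_< ε) (sym (∣-p∣≡∣p∣ (x n))) (small n N≤n)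

  null-+ : ∀ {x y} → Null x → Null y → Null (λ n → x n + y n)
  null-+ {x} {y} hx hy ε 0<ε with M , small-x ← hx (½ * ε) (0<½* 0<ε) | N , small-y ← hy (½ * ε) (0<½* 0<ε) =
    M ℕ.⊔ N , λ n h → begin-strict
      ∣ x n + y n ∣      ≤⟨ ∣p+q∣≤∣p∣+∣q∣ (x n) (y n) ⟩
      ∣ x n ∣ + ∣ y n ∣  <⟨ +-mono-< (small-x n (ℕP.m⊔n≤o⇒m≤o M N h)) (small-y n (ℕP.m⊔n≤o⇒n≤o M N h)) ⟩
      ½ * ε + ½ * ε      ≡⟨ ½*+½* ε ⟩
      ε                  ∎
    where open ≤-Reasoning

  Bounded : (ℕ → ℚ) → Set
  Bounded x = ∃[ B ] (0ℚ < B × ∃[ N ] (∀ n → N ℕ.≤ n → ∣ x n ∣ ≤ B))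

  difference-+ : ∀ a b → (a - b) + b ≡ a
  difference-+ = solve 2 (λ a b → (a :- b) :+ b := a) refl

  cauchy⇒bounded : ∀ {x} → IsCauchy x → Bounded x
  cauchy⇒bounded {x} cx with N , close ← cx 1ℚ (positive⁻¹ 1ℚ) =
    1ℚ + ∣ x N ∣ , +-mono-<-≤ (positive⁻¹ 1ℚ) (0≤∣p∣ (x N)) , N , λ n N≤n → begin
      ∣ x n ∣                  ≡⟨ cong ∣_∣ (difference-+ (x n) (x N)) ⟨
      ∣ (x n - x N) + x N ∣    ≤⟨ ∣p+q∣≤∣p∣+∣q∣ (x n - x N) (x N) ⟩
      ∣ x n - x N ∣ + ∣ x N ∣  ≤⟨ +-monoˡ-≤ ∣ x N ∣ (<⇒≤ (close n N N≤n ℕP.≤-refl)) ⟩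
      1ℚ + ∣ x N ∣             ∎
    where open ≤-Reasoning

  ∣*∣-< : ∀ p q {B δ} → 0ℚ < B → ∣ p ∣ ≤ B → ∣ q ∣ < δ → ∣ p * q ∣ < B * δ
  ∣*∣-< p q {B} {δ} 0<B p≤B q<δ = begin-strict
    ∣ p * q ∣      ≡⟨ ∣p*q∣≡∣p∣*∣q∣ p q ⟩
    ∣ p ∣ * ∣ q ∣  ≤⟨ *-monoʳ-≤-nonNeg ∣ q ∣ {{∣-∣-nonNeg q}} p≤B ⟩
    B * ∣ q ∣      <⟨ *-monoʳ-<-pos B {{positive 0<B}} q<δ ⟩
    B * δ          ∎
    where open ≤-Reasoning

  null-* : ∀ {x y} → Bounded x → Null y → Null (λ n → x n * y n)
  null-* {x} {y} (B , 0<B , M , bounded) hy ε 0<ε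
    with C , 0<C , BC≡1 ← 0<⇒inverse 0<B
    with N , small ← hy (C * ε) (0<* 0<C 0<ε) =
    M ℕ.⊔ N , λ n h → subst (∣ x n * y n ∣ <_)
      (trans (sym (*-assoc B C ε)) (trans (cong (_* ε) BC≡1) (*-identityˡ ε)))
      (∣*∣-< (x n) (y n) 0<B (bounded n (ℕP.m⊔n≤o⇒m≤o M N h)) (small n (ℕP.m⊔n≤o⇒n≤o M N h)))

  Apart : (ℕ → ℚ) → Set
  Apart x = ∃[ δ ] (0ℚ < δ × ∃[ N ] (∀ n → N ℕ.≤ n → δ ≤ ∣ x n ∣))

  apart-¬null : ∀ {x} → Apart x → ¬ Null x
  apart-¬null (δ , 0<δ , M , far) h with N , small ← h δ 0<δ =
    <⇒≱ (small (M ℕ.⊔ N) (ℕP.m≤n⊔m M N)) (far (M ℕ.⊔ N) (ℕP.m≤m⊔n M N))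

  -- Choose N beyond which x moves by less than ε/4 and compare ∣ x N ∣ with ε/2, a decision between
  -- rationals. Below it, later terms stay under 3ε/4; otherwise they stay at least ε/4 from 0.
  small-or-apart : ∀ {x} → IsCauchy x → ∀ ε → 0ℚ < ε → ∃[ N ] (∀ n → N ℕ.≤ n → ∣ x n ∣ < ε) ⊎ Apart x
  small-or-apart {x} cx ε 0<ε with N , close ← cx (½ * (½ * ε)) (0<½* (0<½* 0<ε)) | ∣ x N ∣ <? ½ * ε
  ... | yes xN<h = inj₁ (N , λ n N≤n → begin-strict
      ∣ x n ∣                    ≡⟨ cong ∣_∣ (difference-+ (x n) (x N)) ⟨
      ∣ (x n - x N) + x N ∣      ≤⟨ ∣p+q∣≤∣p∣+∣q∣ (x n - x N) (x N) ⟩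
      ∣ x n - x N ∣ + ∣ x N ∣    <⟨ +-mono-< (close n N N≤n ℕP.≤-refl) xN<h ⟩
      ½ * (½ * ε) + ½ * ε        ≤⟨ +-monoˡ-≤ (½ * ε) (<⇒≤ (begin-strict
          ½ * (½ * ε)                 ≡⟨ +-identityʳ _ ⟨
          ½ * (½ * ε) + 0ℚ            <⟨ +-monoʳ-< (½ * (½ * ε)) (0<½* (0<½* 0<ε)) ⟩
          ½ * (½ * ε) + ½ * (½ * ε)   ≡⟨ ½*+½* (½ * ε) ⟩
          ½ * ε                       ∎)) ⟩
      ½ * ε + ½ * ε              ≡⟨ ½*+½* ε ⟩
      ε                          ∎)
    where open ≤-Reasoning
  ... | no xN≮h = inj₂ (q , 0<½* (0<½* 0<ε) , N , λ n N≤n → begin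
      q                            ≡⟨ solve 1 (λ q → q := (q :+ q) :- q) refl q ⟩
      (q + q) - q                  ≡⟨ cong (_- q) (½*+½* (½ * ε)) ⟩
      ½ * ε - q                    ≤⟨ +-monoˡ-≤ (- q) (≮⇒≥ xN≮h) ⟩
      ∣ x N ∣ - q                  ≡⟨ cong (λ y → ∣ y ∣ - q) (difference-+ (x N) (x n)) ⟨
      ∣ (x N - x n) + x n ∣ - q    ≤⟨ +-monoˡ-≤ (- q) (∣p+q∣≤∣p∣+∣q∣ (x N - x n) (x n)) ⟩
      (∣ x N - x n ∣ + ∣ x n ∣) - q ≤⟨ +-monoˡ-≤ (- q) (+-monoˡ-≤ ∣ x n ∣ (<⇒≤ (close N n ℕP.≤-refl N≤n))) ⟩
      (q + ∣ x n ∣) - q            ≡⟨ solve 2 (λ q a → (q :+ a) :- q := a) refl q ∣ x n ∣ ⟩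
      ∣ x n ∣                      ∎)
    where
    open ≤-Reasoning
    q = ½ * (½ * ε)

  -- For each ε the alternative above is decided constructively, and being apart from 0 refutes the
  -- double negation.
  null-stable : ∀ {x} → IsCauchy x → ¬ ¬ Null x → Null x
  null-stable cx ¬¬null ε 0<ε with small-or-apart cx ε 0<ε
  ... | inj₁ small = small
  ... | inj₂ apart = contradiction (apart-¬null apart) ¬¬null

  ¬null⇒apart : ∀ {x} → IsCauchy x → ¬ Null x → ¬ ¬ Apart x
  ¬null⇒apart cx ¬null ¬apart = ¬null λ ε 0<ε → small ε 0<ε
    where
    small : Null _
    small ε 0<ε with small-or-apart cx ε 0<ε
    ... | inj₁ s = s
    ... | inj₂ a = contradiction a ¬apart

  -- Total, with 0 at 0, because early terms of a sequence that is apart from 0 may vanish.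
  inverse : ℚ → ℚ
  inverse q with q ≟ 0ℚ
  ... | yes _  = 0ℚ
  ... | no q≢0 = (1/ q) {{≢-nonZero q≢0}}

  *-inverse : ∀ q → q ≢ 0ℚ → q * inverse q ≡ 1ℚ
  *-inverse q q≢0 with q ≟ 0ℚ
  ... | yes q≡0 = contradiction q≡0 q≢0
  ... | no q≢0  = *-inverseʳ q {{≢-nonZero q≢0}}

  module _ {x : ℕ → ℚ} (cx : IsCauchy x) (apart : Apart x) where
    private
      δ = proj₁ apart
      0<δ = proj₁ (proj₂ apart)
      M = proj₁ (proj₂ (proj₂ apart))
      far = proj₂ (proj₂ (proj₂ apart))
      D = proj₁ (0<⇒inverse 0<δ)
      0<D = proj₁ (proj₂ (0<⇒inverse 0<δ))
      δD≡1 = proj₂ (proj₂ (0<⇒inverse 0<δ))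

    x*inverse≡1 : ∀ n → M ℕ.≤ n → x n * inverse (x n) ≡ 1ℚ
    x*inverse≡1 n M≤n = *-inverse (x n) λ x≡0 → <⇒≱ 0<δ (subst (λ q → δ ≤ ∣ q ∣) x≡0 (far n M≤n))

    inverse-bounded : ∀ n → M ℕ.≤ n → ∣ inverse (x n) ∣ ≤ D
    inverse-bounded n M≤n = begin
      ∣ y ∣                  ≡⟨ *-identityˡ ∣ y ∣ ⟨
      1ℚ * ∣ y ∣             ≡⟨ cong (_* ∣ y ∣) (trans (sym δD≡1) (*-comm δ D)) ⟩
      D * δ * ∣ y ∣          ≡⟨ *-assoc D δ ∣ y ∣ ⟩
      D * (δ * ∣ y ∣)        ≤⟨ *-monoˡ-≤-nonNeg D {{nonNegative (<⇒≤ 0<D)}} (*-monoʳ-≤-nonNeg ∣ y ∣ {{∣-∣-nonNeg y}} (far n M≤n)) ⟩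
      D * (∣ x n ∣ * ∣ y ∣)  ≡⟨ cong (D *_) (trans (sym (∣p*q∣≡∣p∣*∣q∣ (x n) y)) (cong ∣_∣ (x*inverse≡1 n M≤n))) ⟩
      D * 1ℚ                 ≡⟨ *-identityʳ D ⟩
      D                      ∎
      where
      open ≤-Reasoning
      y = inverse (x n)

    inverse-cauchy : IsCauchy (λ n → inverse (x n))
    -- The tolerance δ²ε compensates the factor a′ b′ in a′ - b′ = a′ b′ (b - a), each inverse being
    -- bounded by D = 1/δ.
    inverse-cauchy ε 0<ε with N , close ← cx (δ * (δ * ε)) (0<* 0<δ (0<* 0<δ 0<ε)) =
      M ℕ.⊔ N , λ m n p q →
        let M≤m = ℕP.m⊔n≤o⇒m≤o M N p
            M≤n = ℕP.m⊔n≤o⇒m≤o M N q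
            a = x m ; b = x n ; a′ = inverse a ; b′ = inverse b in begin-strict
        ∣ a′ - b′ ∣                          ≡⟨ cong ∣_∣ (cong₂ _-_ (sym (*-identityʳ a′)) (sym (*-identityʳ b′))) ⟩
        ∣ a′ * 1ℚ - b′ * 1ℚ ∣                ≡⟨ cong ∣_∣ (cong₂ (λ u v → a′ * u - b′ * v) (sym (x*inverse≡1 n M≤n)) (sym (x*inverse≡1 m M≤m))) ⟩
        ∣ a′ * (b * b′) - b′ * (a * a′) ∣    ≡⟨ cong ∣_∣ (solve 4 (λ a b a′ b′ → a′ :* (b :* b′) :- b′ :* (a :* a′) := a′ :* (b′ :* (b :- a))) refl a b a′ b′) ⟩
        ∣ a′ * (b′ * (b - a)) ∣              <⟨ ∣*∣-< a′ (b′ * (b - a)) 0<D (inverse-bounded m M≤m)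
                                                 (∣*∣-< b′ (b - a) 0<D (inverse-bounded n M≤n)
                                                   (close n m (ℕP.m⊔n≤o⇒n≤o M N q) (ℕP.m⊔n≤o⇒n≤o M N p))) ⟩
        D * (D * (δ * (δ * ε)))              ≡⟨ solve 3 (λ D δ ε → D :* (D :* (δ :* (δ :* ε))) := (δ :* D) :* ((δ :* D) :* ε)) refl D δ ε ⟩
        (δ * D) * ((δ * D) * ε)              ≡⟨ trans (cong₂ (λ u v → u * (v * ε)) δD≡1 δD≡1) (trans (*-identityˡ _) (*-identityˡ ε)) ⟩
        ε                                    ∎
      where open ≤-Reasoning

  apart⇒inverse : ∀ x → Apart (seq x) → ∃[ y ] (x *ℝ y ≈ℝ fromℚ 1ℚ)
  apart⇒inverse x apart@(_ , _ , M , _) =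
    mkℝ (λ n → inverse (seq x n)) (inverse-cauchy (cauchy x) apart) ,
    λ ε 0<ε → M , λ n M≤n → subst (_< ε) (sym (cong (λ q → ∣ q - 1ℚ ∣) (x*inverse≡1 (cauchy x) apart n M≤n))) 0<ε

  pointwise : ∀ {x y : ℕ → ℚ} → (∀ n → x n ≡ y n) → Null (λ n → x n - y n)
  pointwise {x} {y} h = null-≗ (λ n → sym (trans (cong (_- y n) (h n)) (+-inverseʳ (y n)))) null-0

  ≈ℝ-refl : ∀ {x} → x ≈ℝ x
  ≈ℝ-refl {x} = pointwise {seq x} λ _ → refl

  ≈ℝ-sym : ∀ {x y} → x ≈ℝ y → y ≈ℝ x
  ≈ℝ-sym {x} {y} h = null-≗ (λ n → solve 2 (λ a b → :- (a :- b) := b :- a) refl (seq x n) (seq y n)) (null-neg h)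

  ≈ℝ-trans : ∀ {x y z} → x ≈ℝ y → y ≈ℝ z → x ≈ℝ z
  ≈ℝ-trans {x} {y} {z} h k = null-≗
    (λ n → solve 3 (λ a b c → (a :- b) :+ (b :- c) := a :- c) refl (seq x n) (seq y n) (seq z n)) (null-+ h k)

  +ℝ-cong : ∀ {x y u v} → x ≈ℝ y → u ≈ℝ v → x +ℝ u ≈ℝ y +ℝ v
  +ℝ-cong {x} {y} {u} {v} h k = null-≗
    (λ n → solve 4 (λ a b c d → (a :- b) :+ (c :- d) := (a :+ c) :- (b :+ d)) refl (seq x n) (seq y n) (seq u n) (seq v n)) (null-+ h k)

  -ℝ-cong : ∀ {x y} → x ≈ℝ y → -ℝ x ≈ℝ -ℝ y
  -ℝ-cong {x} {y} h = null-≗ (λ n → solve 2 (λ a b → :- (a :- b) := (:- a) :- (:- b)) refl (seq x n) (seq y n)) (null-neg h)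

  *ℝ-cong : ∀ {x y u v} → x ≈ℝ y → u ≈ℝ v → x *ℝ u ≈ℝ y *ℝ v
  *ℝ-cong {x} {y} {u} {v} h k = null-≗
    (λ n → solve 4 (λ a b c d → a :* (c :- d) :+ d :* (a :- b) := a :* c :- b :* d) refl (seq x n) (seq y n) (seq u n) (seq v n))
    (null-+ (null-* {seq x} (cauchy⇒bounded (cauchy x)) k) (null-* {seq v} (cauchy⇒bounded (cauchy v)) h))

  ≈ℝ-stable : ∀ {x y} → ¬ ¬ (x ≈ℝ y) → x ≈ℝ y
  ≈ℝ-stable {x} {y} = null-stable (+-cauchy (seq x) _ (cauchy x) (neg-cauchy (seq y) (cauchy y)))

  fromℚ-injective : ∀ {p q} → fromℚ p ≈ℝ fromℚ q → p ≡ q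
  fromℚ-injective {p} {q} h with p - q ≟ 0ℚ
  ... | yes p-q≡0 = trans (sym (difference-+ p q)) (trans (cong (_+ q) p-q≡0) (+-identityˡ q))
  ... | no p-q≢0 = contradiction h (apart-¬null (∣ p - q ∣ , 0<∣p-q∣ , 0 , λ _ _ → ≤-refl))
    where
    0<∣p-q∣ : 0ℚ < ∣ p - q ∣
    0<∣p-q∣ = ≰⇒> λ ∣p-q∣≤0 → p-q≢0 (∣p∣≡0⇒p≡0 _ (≤-antisym ∣p-q∣≤0 (0≤∣p∣ _)))

  ℂ-commutativeRing : CommutativeRing _ _
  ℂ-commutativeRing = record
    { RawRing ℂ-rawRing
    ; isCommutativeRing = record
      { isRing = record
        { +-isAbelianGroup = record
          { isGroup = record
            { isMonoid = record
              { isSemigroup = record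
                { isMagma = record
                  { isEquivalence = record
                    { refl  = λ {z} → ≈ℝ-refl {re z} , ≈ℝ-refl {im z}
                    ; sym   = λ {z} {w} (p , q) → ≈ℝ-sym {re z} {re w} p , ≈ℝ-sym {im z} {im w} q
                    ; trans = λ {z} {w} {v} (p , q) (r , s) → ≈ℝ-trans {re z} {re w} {re v} p r , ≈ℝ-trans {im z} {im w} {im v} q s
                    }
                  ; ∙-cong = λ {z} {w} {u} {v} (p , q) (r , s) →
                      +ℝ-cong {re z} {re w} {re u} {re v} p r , +ℝ-cong {im z} {im w} {im u} {im v} q s
                  }
                ; assoc = λ z w v → pointwise (λ n → +-assoc (seq (re z) n) _ _) , pointwise (λ n → +-assoc (seq (im z) n) _ _)
                }
              ; identity = (λ z → pointwise (λ n → +-identityˡ (seq (re z) n)) , pointwise (λ n → +-identityˡ (seq (im z) n)))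
                         , (λ z → pointwise (λ n → +-identityʳ (seq (re z) n)) , pointwise (λ n → +-identityʳ (seq (im z) n)))
              }
            ; inverse = (λ z → pointwise (λ n → +-inverseˡ (seq (re z) n)) , pointwise (λ n → +-inverseˡ (seq (im z) n)))
                      , (λ z → pointwise (λ n → +-inverseʳ (seq (re z) n)) , pointwise (λ n → +-inverseʳ (seq (im z) n)))
            ; ⁻¹-cong = λ {z} {w} (p , q) → -ℝ-cong {re z} {re w} p , -ℝ-cong {im z} {im w} q
            }
          ; comm = λ z w → pointwise (λ n → +-comm (seq (re z) n) _) , pointwise (λ n → +-comm (seq (im z) n) _)
          }
        ; *-cong = λ {z} {w} {u} {v} (p , q) (r , s) →
            +ℝ-cong {re z *ℝ re u} {re w *ℝ re v} { -ℝ (im z *ℝ im u)} { -ℝ (im w *ℝ im v)} (*ℝ-cong {re z} {re w} {re u} {re v} p r)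
              (-ℝ-cong {im z *ℝ im u} {im w *ℝ im v} (*ℝ-cong {im z} {im w} {im u} {im v} q s))
          , +ℝ-cong {re z *ℝ im u} {re w *ℝ im v} {im z *ℝ re u} {im w *ℝ re v}
              (*ℝ-cong {re z} {re w} {im u} {im v} p s) (*ℝ-cong {im z} {im w} {re u} {re v} q r)
        ; *-assoc = λ (a +i b) (c +i d) (e +i f) →
            pointwise (λ n → solve 6 (λ a b c d e f →
              (a :* c :+ :- (b :* d)) :* e :+ :- ((a :* d :+ b :* c) :* f) :=
              a :* (c :* e :+ :- (d :* f)) :+ :- (b :* (c :* f :+ d :* e))) refl
              (seq a n) (seq b n) (seq c n) (seq d n) (seq e n) (seq f n))
          , pointwise (λ n → solve 6 (λ a b c d e f →
              (a :* c :+ :- (b :* d)) :* f :+ (a :* d :+ b :* c) :* e :=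
              a :* (c :* f :+ d :* e) :+ b :* (c :* e :+ :- (d :* f))) refl
              (seq a n) (seq b n) (seq c n) (seq d n) (seq e n) (seq f n))
        ; *-identity =
            (λ (a +i b) →
              pointwise (λ n → solve 2 (λ a b → con 1ℚ :* a :+ :- (con 0ℚ :* b) := a) refl (seq a n) (seq b n))
            , pointwise (λ n → solve 2 (λ a b → con 1ℚ :* b :+ con 0ℚ :* a := b) refl (seq a n) (seq b n)))
          , (λ (a +i b) →
              pointwise (λ n → solve 2 (λ a b → a :* con 1ℚ :+ :- (b :* con 0ℚ) := a) refl (seq a n) (seq b n))
            , pointwise (λ n → solve 2 (λ a b → a :* con 0ℚ :+ b :* con 1ℚ := b) refl (seq a n) (seq b n)))
        ; distrib =
            (λ (a +i b) (c +i d) (e +i f) →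
              pointwise (λ n → solve 6 (λ a b c d e f →
                a :* (c :+ e) :+ :- (b :* (d :+ f)) :=
                (a :* c :+ :- (b :* d)) :+ (a :* e :+ :- (b :* f))) refl
                (seq a n) (seq b n) (seq c n) (seq d n) (seq e n) (seq f n))
            , pointwise (λ n → solve 6 (λ a b c d e f →
                a :* (d :+ f) :+ b :* (c :+ e) := (a :* d :+ b :* c) :+ (a :* f :+ b :* e)) refl
                (seq a n) (seq b n) (seq c n) (seq d n) (seq e n) (seq f n)))
          , (λ (a +i b) (c +i d) (e +i f) →
              pointwise (λ n → solve 6 (λ a b c d e f →
                (c :+ e) :* a :+ :- ((d :+ f) :* b) :=
                (c :* a :+ :- (d :* b)) :+ (e :* a :+ :- (f :* b))) refl
                (seq a n) (seq b n) (seq c n) (seq d n) (seq e n) (seq f n))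
            , pointwise (λ n → solve 6 (λ a b c d e f →
                (c :+ e) :* b :+ (d :+ f) :* a := (c :* b :+ d :* a) :+ (e :* b :+ f :* a)) refl
                (seq a n) (seq b n) (seq c n) (seq d n) (seq e n) (seq f n)))
        }
      ; *-comm = λ (a +i b) (c +i d) →
          pointwise (λ n → solve 4 (λ a b c d → a :* c :+ :- (b :* d) := c :* a :+ :- (d :* b)) refl
            (seq a n) (seq b n) (seq c n) (seq d n))
        , pointwise (λ n → solve 4 (λ a b c d → a :* d :+ b :* c := c :* b :+ d :* a) refl
            (seq a n) (seq b n) (seq c n) (seq d n))
      }
    }
    where open import Algebra.Bundles.Raw using (module RawRing)

  norm² : ℂ → ℝ
  norm² (a +i b) = a *ℝ a +ℝ b *ℝ b

  ∣q∣²≡q² : ∀ q → ∣ q ∣ * ∣ q ∣ ≡ q * q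
  ∣q∣²≡q² q with ∣p∣≡p∨∣p∣≡-p q
  ... | inj₁ e = cong₂ _*_ e e
  ... | inj₂ e = trans (cong₂ _*_ e e) (solve 1 (λ q → (:- q) :* (:- q) := q :* q) refl q)

  0≤q² : ∀ q → 0ℚ ≤ q * q
  0≤q² q = subst₂ _≤_ (*-zeroʳ ∣ q ∣) (∣q∣²≡q² q) (*-monoˡ-≤-nonNeg ∣ q ∣ {{∣-∣-nonNeg q}} (0≤∣p∣ q))

  q≤∣q∣ : ∀ q → q ≤ ∣ q ∣
  q≤∣q∣ q with ∣p∣≡p∨∣p∣≡-p q
  ... | inj₁ e = ≤-reflexive (sym e)
  ... | inj₂ e with q ≤? 0ℚ
  ...   | yes q≤0 = ≤-trans q≤0 (0≤∣p∣ q)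
  ...   | no q≰0  = ≤-reflexive (sym (0≤p⇒∣p∣≡p (<⇒≤ (≰⇒> q≰0))))

  apart-sum-of-squares : ∀ {x y : ℕ → ℚ} → Apart x → Apart (λ n → x n * x n + y n * y n)
  apart-sum-of-squares {x} {y} (δ , 0<δ , N , far) = δ * δ , 0<* 0<δ 0<δ , N , λ n N≤n → begin
    δ * δ                        ≤⟨ *-monoˡ-≤-nonNeg δ {{nonNegative (<⇒≤ 0<δ)}} (far n N≤n) ⟩
    δ * ∣ x n ∣                  ≤⟨ *-monoʳ-≤-nonNeg ∣ x n ∣ {{∣-∣-nonNeg (x n)}} (far n N≤n) ⟩
    ∣ x n ∣ * ∣ x n ∣            ≡⟨ ∣q∣²≡q² (x n) ⟩
    x n * x n                    ≡⟨ +-identityʳ _ ⟨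
    x n * x n + 0ℚ               ≤⟨ +-monoʳ-≤ (x n * x n) (0≤q² (y n)) ⟩
    x n * x n + y n * y n        ≤⟨ q≤∣q∣ _ ⟩
    ∣ x n * x n + y n * y n ∣    ∎
    where open ≤-Reasoning

  open CommutativeRing ℂ-commutativeRing using (_≈_; 0#; 1#) renaming (_*_ to _*ᶜ_; _+_ to _+ᶜ_)

  ≈-stable : ∀ z w → ¬ ¬ (z ≈ w) → z ≈ w
  ≈-stable z w h =
    ≈ℝ-stable {re z} {re w} (λ ¬e → h λ e → ¬e (proj₁ e)) , ≈ℝ-stable {im z} {im w} (λ ¬e → h λ e → ¬e (proj₂ e))

  -- The squared norm dominates each of the two squares, so if it is not apart from 0, neither part
  -- of z is. Both parts are then null by stability, and z = 0.
  ≉0⇒norm²-apart : ∀ z → ¬ (z ≈ 0#) → ¬ ¬ Apart (seq (norm² z))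
  ≉0⇒norm²-apart (a +i b) z≉0 ¬apart = z≉0 (part a (λ h → ¬apart (apart-sum-of-squares {seq a} {seq b} h)) , part b (λ h → ¬apart (swap h)))
    where
    part : ∀ x → ¬ Apart (seq x) → x ≈ℝ fromℚ 0ℚ
    part x ¬apart = null-≗ {seq x} (λ n → sym (+-identityʳ (seq x n)))
      (null-stable (cauchy x) λ ¬null → ¬null⇒apart (cauchy x) ¬null ¬apart)
    swap : Apart (seq b) → Apart (seq (norm² (a +i b)))
    swap h with δ , 0<δ , N , far ← apart-sum-of-squares {seq b} {seq a} h =
      δ , 0<δ , N , λ n N≤n → subst (λ q → δ ≤ ∣ q ∣) (+-comm (seq b n * seq b n) _) (far n N≤n)

  ℂ-invert : ∀ z → ¬ (z ≈ 0#) → ¬ ¬ (∃[ w ] z *ᶜ w ≈ 1#)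
  ℂ-invert z@(a +i b) z≉0 = do
    apart    ← ≉0⇒norm²-apart z z≉0
    (m , eq) ← return (apart⇒inverse (norm² z) apart)
    -- The conjugate of z times the inverse m of the squared norm.
    return (((a *ℝ m) +i (-ℝ (b *ℝ m))) ,
      ≈ℝ-trans {re (z *ᶜ ((a *ℝ m) +i (-ℝ (b *ℝ m))))} {norm² z *ℝ m} {fromℚ 1ℚ}
        (pointwise (λ n → solve 3 (λ a b m → a :* (a :* m) :+ :- (b :* (:- (b :* m))) := (a :* a :+ b :* b) :* m) refl
          (seq a n) (seq b n) (seq m n))) eq ,
      pointwise (λ n → solve 3 (λ a b m → a :* (:- (b :* m)) :+ b :* (a :* m) := con 0ℚ) refl
        (seq a n) (seq b n) (seq m n)))

  ℂ-classicalField : ClassicalField _ _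
  ℂ-classicalField = record
    { commutativeRing = ℂ-commutativeRing
    ; stable          = λ {z} {w} → ≈-stable z w
    ; invert          = λ {z} → ℂ-invert z
    ; 1+1≉0           = λ h → contradiction (fromℚ-injective {1ℚ + 1ℚ} {0ℚ} (proj₁ h)) λ ()
    ; ν               = λ n → fromℚ (fromℕ n) +i fromℚ 0ℚ
    ; ν-injective     = λ {m} {n} h → fromℕ-injective m n (fromℚ-injective (proj₁ h))
    }
    where
    -- In normal form from the start, with 0 as predecessor of the denominator, so that injectivity
    -- is read off the numerator.
    fromℕ : ℕ → ℚ
    fromℕ n = mkℚ (+ n) 0 (Coprime.sym (Coprime.1-coprimeTo n))
    fromℕ-injective : ∀ m n → fromℕ m ≡ fromℕ n → m ≡ n
    fromℕ-injective m n e = ℤP.+-injective (cong ℚ.numerator e)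

  fromℚᶜ : ℚ → ℂ
  fromℚᶜ q = fromℚ q +i fromℚ 0ℚ

  private module C = CommutativeRing ℂ-commutativeRing

  fromℚᶜ-+ : ∀ p q → fromℚᶜ (p + q) C.≈ fromℚᶜ p C.+ fromℚᶜ q
  fromℚᶜ-+ p q =
    pointwise {λ _ → p + q} {λ _ → p + q} (λ _ → refl) ,
    pointwise {λ _ → 0ℚ} {λ _ → 0ℚ + 0ℚ} (λ _ → refl)

  fromℚᶜ-* : ∀ p q → fromℚᶜ (p * q) C.≈ fromℚᶜ p C.* fromℚᶜ q
  fromℚᶜ-* p q =
    pointwise {λ _ → p * q} {λ _ → p * q + - (0ℚ * 0ℚ)}
      (λ _ → solve 2 (λ p q → p :* q := p :* q :+ :- (con 0ℚ :* con 0ℚ)) refl p q) ,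
    pointwise {λ _ → 0ℚ} {λ _ → p * 0ℚ + 0ℚ * q}
      (λ _ → solve 2 (λ p q → con 0ℚ := p :* con 0ℚ :+ con 0ℚ :* q) refl p q)

  fromℚᶜ-neg : ∀ q → fromℚᶜ (- q) C.≈ C.- fromℚᶜ q
  fromℚᶜ-neg q =
    pointwise {λ _ → - q} {λ _ → - q} (λ _ → refl) ,
    pointwise {λ _ → 0ℚ} {λ _ → - 0ℚ} (λ _ → refl)

  fromℚᶜ-injective : ∀ {p q} → fromℚᶜ p C.≈ fromℚᶜ q → p ≡ q
  fromℚᶜ-injective h = fromℚ-injective (proj₁ h)

-- Assembly: bounds over ℂ and the families in small dimensions

open Arithmetic using (α-value)
open ComplexNumbers
open import Defs
private
  module U = UpperBound ℂ-classicalField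
  module L = LowerBound ℂ-commutativeRing
  module ℂF = Families ℂ-commutativeRing
  ℚMatrix : ℕ → Set
  ℚMatrix = SquareMatrix.Matrix ℚ.+-*-rawRing

upper-bound : ∀ n k → HasFamily n k → k ℕ.≤ α-value n
upper-bound n k F = let e , anti , sq = ℂF.Family⇒Family· F in U.anticommuting-bound n e anti sq

large-family : ∀ m → HasFamily (2 ℕ.+ m) (suc (m ℕ.+ m))
large-family m = ℂF.Family·⇒Family (L.family , L.family-anti , L.family-sq U.1≉0)

rational? : ∀ {n k} (e : Fin k → ℚMatrix n) → Dec (ℂF.Rational e)
rational? e =
  FinP.all? (λ i → FinP.all? λ j → ¬? (i FinP.≟ j) →-dec FinP.all? λ x → FinP.all? λ y → _ ℚP.≟ _)
  ×-dec FinP.all? λ i → ¬? (FinP.all? λ x → FinP.all? λ y → _ ℚP.≟ _)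

ℂ-rational-family : ∀ {n k} (e : Fin k → ℚMatrix n) → True (rational? e) → HasFamily n k
ℂ-rational-family e t = ℂF.rational-family fromℚᶜ fromℚᶜ-+ fromℚᶜ-* fromℚᶜ-neg
  (CommutativeRing.refl ℂ-commutativeRing {fromℚᶜ 0ℚ}) fromℚᶜ-injective e (toWitness t)

-- The second Pauli matrix is multiplied by i and placed last, which makes it rational; its square
-- becomes minus the identity, still nonzero.
pauli : Fin 3 → ℚMatrix 2
pauli zero             zero       zero       = 1ℚ
pauli zero             (suc zero) (suc zero) = ℚ.- 1ℚ
pauli (suc zero)       zero       (suc zero) = 1ℚ
pauli (suc zero)       (suc zero) zero       = 1ℚ
pauli (suc (suc zero)) zero       (suc zero) = 1ℚ
pauli (suc (suc zero)) (suc zero) zero       = ℚ.- 1ℚ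
pauli _                _          _          = 0ℚ

-- Matrices supported on different diagonal blocks have zero products both ways, hence anticommute.
-- Sizes therefore add, giving 3 + 1 for n = 3 and 3 + 3 for n = 4.
blocks : ∀ {m n k l} → (Fin k → ℚMatrix m) → (Fin l → ℚMatrix n) → Fin (k ℕ.+ l) → ℚMatrix (m ℕ.+ n)
blocks {m} {k = k} e f s i j with splitAt k s | splitAt m i | splitAt m j
... | inj₁ s | inj₁ i | inj₁ j = e s i j
... | inj₂ s | inj₂ i | inj₂ j = f s i j
... | _      | _      | _      = 0ℚ

unit : Fin 1 → ℚMatrix 1
unit _ _ _ = 1ℚ

open import Data.Nat.Base using (ℕ; _*_; _∸_; _≤_; _>_)
open import Data.Product.Base using (_×_)
open import Data.Sum.Base using (_⊎_)
open import Relation.Binary.PropositionalEquality using (_≡_)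

theorem5p2 : ∀ (n : ℕ) → 1 ≤ n →
    ((n ≡ 1 ⊎ n ≡ 2) → α[ n ]≐ (2 * n ∸ 1)) ×
    ((n ≡ 3 ⊎ n ≡ 4) → α[ n ]≐ (2 * n ∸ 2)) ×
    (n > 4 → α[ n ]≐ (2 * n ∸ 3))
theorem5p2 n _ =
    (λ { (inj₁ ≡.refl) → ℂ-rational-family unit _ , upper-bound 1
       ; (inj₂ ≡.refl) → ℂ-rational-family pauli _ , upper-bound 2 })
  , (λ { (inj₁ ≡.refl) → ℂ-rational-family (blocks pauli unit) _ , upper-bound 3
       ; (inj₂ ≡.refl) → ℂ-rational-family (blocks pauli pauli) _ , upper-bound 4 })
  , large
  where
  open ℕ-Solver
  large : ∀ {n} → n > 4 → α[ n ]≐ (2 * n ∸ 3)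
  large (s≤s (s≤s (s≤s (s≤s (s≤s {n = m} _))))) =
      ≡.subst (HasFamily (5 ℕ.+ m)) (≡.trans family-size value) (large-family (3 ℕ.+ m))
    , λ k h → ℕP.≤-trans (upper-bound (5 ℕ.+ m) k h) (ℕP.≤-reflexive value)
    where
    family-size : suc (3 ℕ.+ m ℕ.+ (3 ℕ.+ m)) ≡ 7 ℕ.+ (m ℕ.+ m)
    family-size = solve 1 (λ m → con 1 :+ (con 3 :+ m :+ (con 3 :+ m)) := con 7 :+ (m :+ m)) ≡.refl m
    value : 7 ℕ.+ (m ℕ.+ m) ≡ 2 * (5 ℕ.+ m) ∸ 3
    value = ≡.trans (≡.sym (ℕP.m+n∸n≡m _ 3))
      (≡.cong (_∸ 3) (solve 1 (λ m → con 7 :+ (m :+ m) :+ con 3 := con 2 :* (con 5 :+ m)) ≡.refl m))
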